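{- Let $B$ be a basic block and let $k\ge1$ and $\alpha^{(1)},\dots,\alpha^{(k)}\in\{(2),(1,1)\}$. Define $D_0=B$ and $D_i=\alpha^{(i)}\bullet D_{i-1}$ for $1\le i\le k$, and let $D=D_k=\alpha^{(k)}\bullet\cdots\bullet\alpha^{(1)}\bullet B$. Then $\mathfrak{r}_D$ is $p$-positive.
   Context: Boxes are indexed $(i,j)$, row $i$ from the top, column $j$ from the left. For a composition $\alpha=(\alpha_1,\dots,\alpha_\ell)$, the ribbon $\alpha$ is the set of boxes in which row $i$ has $\alpha_i$ consecutive boxes and, for $i<\ell$, the leftmost box of row $i$ lies directly above the rightmost box of row $i+1$; we identify a ribbon with its composition. A marked shifted tableau of it is a filling by letters of $\{1'<1<2'<2<\cdots\}$ with weakly increasing rows and columns, at most one unmarked $k$ per column and at most one $k'$ per row for each $k$; the content $(c_1,c_2,\dots)$ counts entries with unmarked value $i$. $\mathfrak{r}_\alpha=\sum_Tx_1^{c_1}x_2^{c_2}\cdots$ over all such tableaux. The transpose $D^t$ of a ribbon $D$ is its reflection in the main diagonal ($(i,j)\mapsto(j,i)$), and the antipodal rotation $D^\circ$ is its rotation by $180$ degrees; both are again ribbons. If $D$ has composition $(\beta_1,\dots,\beta_s)$ and $D^t$ has composition $(\gamma_1,\dots,\gamma_t)$, then $(1,1)\bullet D$ is the ribbon $(\beta_1,\dots,\beta_s,\gamma_1,\dots,\gamma_t)$ (concatenation $D\cdot D^t$) and $(2)\bullet D$ is the ribbon $(\beta_1,\dots,\beta_{s-1},\beta_s+\gamma_1,\gamma_2,\dots,\gamma_t)$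 (near concatenation $D\odot D^t$). For $1\le k\le n$, $\triangle_{n,k}$ is the ribbon $(1^{k-1},n-k+1)$. The set of basic blocks of size $n$ is $\mathfrak{B}_n=\{\triangle_{n,1},\triangle_{n,1}^t,\triangle_{n,3},\triangle_{n,3}^t,\triangle_{n,3}^\circ,(\triangle_{n,3}^t)^\circ\}$ for $n\ge3$ and $\mathfrak{B}_n=\{\triangle_{n,1},\triangle_{n,1}^t\}$ for $n\le 2$; a basic block is an element of $\bigcup_{n\ge1}\mathfrak{B}_n$. A symmetric function is $p$-positive if all its coefficients in the power sum basis are nonnegative. -}

module Defs where

open import Data.Bool using (Bool; true; false; _∧_; _∨_; not; if_then_else_)
open import Data.Nat as ℕ using (ℕ; zero; suc; _∸_; _≤_)
open import Data.Integer as ℤ using (ℤ; +_)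
open import Data.Fin using (Fin; toℕ)
import Data.Fin as Fin
open import Data.List using (List; []; _∷_; [_]; _++_; map; length; replicate; upTo; allFin;
  concatMap; cartesianProduct; zip; filterᵇ; foldr)
open import Data.List.Relation.Unary.All using (All)
open import Data.List.Membership.Propositional using (_∈_)
open import Data.Product using (Σ; _×_; _,_)
open import Data.Sum using (_⊎_)
open import Data.Rational as ℚ using (ℚ; 0ℚ)
open import Relation.Nullary using (does)
open import Relation.Binary.PropositionalEquality using (_≡_)

IsComp : List ℕ → Set
IsComp α = All (λ x → 1 ≤ x) α

-- boxes of the ribbon α, as (row , column) in ℤ × ℤ; row index grows
-- downwards, column index grows to the right.  The rightmost box of row 1
-- is placed at (0,0); (placement is only fixed up to translation).
-- Row i has α_i consecutive boxes, and the leftmost box of row i lies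
-- directly above the rightmost box of row i+1.
boxesAt : ℤ → ℤ → List ℕ → List (ℤ × ℤ)
boxesAt r c [] = []
boxesAt r c (a ∷ as) =
  map (λ t → (r , c ℤ.- + t)) (upTo a) ++ boxesAt (r ℤ.+ + 1) (c ℤ.- + (a ∸ 1)) as

boxes : List ℕ → List (ℤ × ℤ)
boxes = boxesAt (+ 0) (+ 0)

SameSet : List (ℤ × ℤ) → List (ℤ × ℤ) → Set
SameSet L M = ∀ p → (p ∈ L → p ∈ M) × (p ∈ M → p ∈ L)

Transposed : List ℕ → List ℕ → Set
Transposed β γ = IsComp γ × Σ ℤ λ a → Σ ℤ λ b →
  SameSet (boxes γ) (map (λ { (i , j) → (j ℤ.+ a , i ℤ.+ b) }) (boxes β))

Rotated : List ℕ → List ℕ → Set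
Rotated β γ = IsComp γ × Σ ℤ λ a → Σ ℤ λ b →
  SameSet (boxes γ) (map (λ { (i , j) → (a ℤ.- i , b ℤ.- j) }) (boxes β))

nearConcat : List ℕ → List ℕ → List ℕ
nearConcat [] γ = γ
nearConcat (b ∷ []) [] = b ∷ []
nearConcat (b ∷ []) (g ∷ gs) = (b ℕ.+ g) ∷ gs
nearConcat (b ∷ b' ∷ bs) γ = b ∷ nearConcat (b' ∷ bs) γ

tri : ℕ → ℕ → List ℕ
tri n k = replicate (k ∸ 1) 1 ++ [ n ∸ k ℕ.+ 1 ]

BasicBlock : List ℕ → Set
BasicBlock B = Σ ℕ λ n → 1 ≤ n ×
  ( B ≡ tri n 1
  ⊎ Transposed (tri n 1) B
  ⊎ (3 ≤ n × ( B ≡ tri n 3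
             ⊎ Transposed (tri n 3) B
             ⊎ Rotated (tri n 3) B
             ⊎ (Σ (List ℕ) λ E → Transposed (tri n 3) E × Rotated E B))))

-- Iterated: Reach k D  iff  D = α^{(k)} • ⋯ • α^{(1)} • B for a basic block B
-- and some α^{(i)} ∈ {(2),(1,1)}.
--   (1,1) • D = D · D^t  (concatenation),  (2) • D = D ⊙ D^t (near concatenation)
data Reach : ℕ → List ℕ → Set where
  base  : ∀ {B} → BasicBlock B → Reach 0 B
  step11 : ∀ {k D E} → Reach k D → Transposed D E → Reach (suc k) (D ++ E)
  step2  : ∀ {k D E} → Reach k D → Transposed D E → Reach (suc k) (nearConcat D E)

-- a letter: (v , marked) stands for (v+1)' if marked, (v+1) otherwise
Letter : ℕ → Set
Letter m = Fin m × Bool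

letters : (m : ℕ) → List (Letter m)
letters m = cartesianProduct (allFin m) (true ∷ false ∷ [])

allᵇ : ∀ {A : Set} → (A → Bool) → List A → Bool
allᵇ p [] = true
allᵇ p (x ∷ xs) = p x ∧ allᵇ p xs

-- position in the order 1' < 1 < 2' < 2 < ⋯
key : ∀ {m} → Letter m → ℕ
key (v , mk) = 2 ℕ.* toℕ v ℕ.+ (if mk then 0 else 1)

_==ℤ_ : ℤ → ℤ → Bool
x ==ℤ y = does (x ℤ.≟ y)

_<ℤ_ : ℤ → ℤ → Bool
x <ℤ y = (x ℤ.+ + 1) ℤ.≤ᵇ y

_==F_ : ∀ {m} → Fin m → Fin m → Bool
x ==F y = does (x Fin.≟ y)

okPair : ∀ {m} → (ℤ × ℤ) × Letter m → (ℤ × ℤ) × Letter m → Bool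
okPair ((i , j) , (v , mk)) ((i' , j') , (v' , mk')) =
     (not (i ==ℤ i' ∧ j <ℤ j') ∨ (key (v , mk) ℕ.≤ᵇ key (v' , mk')))
  ∧  (not (j ==ℤ j' ∧ i <ℤ i') ∨ (key (v , mk) ℕ.≤ᵇ key (v' , mk')))
  ∧  not (j ==ℤ j' ∧ not mk ∧ not mk' ∧ v ==F v')
  ∧  not (i ==ℤ i' ∧ mk ∧ mk' ∧ v ==F v')

allPairsOK : ∀ {m} → List ((ℤ × ℤ) × Letter m) → Bool
allPairsOK [] = true
allPairsOK (x ∷ xs) = allᵇ (λ y → okPair x y ∧ okPair y x) xs ∧ allPairsOK xs

listsOf : ∀ {A : Set} → List A → ℕ → List (List A)
listsOf xs zero = [ [] ]
listsOf xs (suc n) = concatMap (λ x → map (x ∷_) (listsOf xs n)) xs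

contentIs : ∀ {m} → List (Letter m) → (Fin m → ℕ) → Bool
contentIs {m} T a =
  allᵇ (λ i → length (filterᵇ (λ { (v , _) → v ==F i }) T) ℕ.≡ᵇ a i) (allFin m)

-- coefficient of x_1^{a_1}⋯x_m^{a_m} in 𝔯_α
-- (monomials in the first m variables: tableaux with values ≤ m)
rcoeff : List ℕ → (m : ℕ) → (Fin m → ℕ) → ℕ
rcoeff α m a =
  length (filterᵇ (λ T → allPairsOK (zip (boxes α) T) ∧ contentIs T a)
                  (listsOf (letters m) (length (boxes α))))

-- coefficient of x_1^{a_1}⋯x_m^{a_m} in p_λ = ∏_j (x_1^{λ_j} + x_2^{λ_j} + ⋯):
-- number of maps f from parts of λ to variables with Σ_{f(j)=i} λ_j = a_i
weightIs : ∀ {m} → List ℕ → List (Fin m) → (Fin m → ℕ) → Bool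
weightIs {m} λs f a =
  allᵇ (λ i → foldr ℕ._+_ 0 (map (λ { (l , v) → if v ==F i then l else 0 }) (zip λs f))
             ℕ.≡ᵇ a i) (allFin m)

pcoeff : List ℕ → (m : ℕ) → (Fin m → ℕ) → ℕ
pcoeff λs m a = length (filterᵇ (λ f → weightIs λs f a) (listsOf (allFin m) (length λs)))

toℚ : ℕ → ℚ
toℚ n = (+ n) ℚ./ 1

-- 𝔯_α is p-positive: 𝔯_α = Σ c_λ p_λ (finite sum) with all c_λ ≥ 0,
-- as formal power series (checked on every monomial in every finite set
-- of variables x_1..x_m)
PPositive : List ℕ → Set
PPositive α = Σ (List (List ℕ × ℚ)) λ L →
  All (λ { (λs , c) → IsComp λs × 0ℚ ℚ.≤ c }) L ×
  (∀ (m : ℕ) (a : Fin m → ℕ) →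
     toℚ (rcoeff α m a) ≡ foldr ℚ._+_ 0ℚ (map (λ { (λs , c) → c ℚ.* toℚ (pcoeff λs m a) }) L))

{-# OPTIONS --safe #-}

-- Whether a letter may follow another one to the left or below does not depend on the mark of the
-- new letter, and exactly one of the two placements is allowed. So 𝔯_α counts all sequences of
-- letters by their pattern of left and down steps, which gives 𝔯_α 𝔯_β = 𝔯_{α·β} + 𝔯_{α⊙β}.
-- Adding the variables one by one gives the Newton identity n qₙ = Σ_{k odd} 2 pₖ qₙ₋ₖ, both for
-- rows and for columns. Hence rows and columns of the same size have the same function, and by the
-- product rule 𝔯 is invariant under transposition and rotation. As (D·Dᵗ)ᵗ = D⊙Dᵗ, both ribbons
-- α • D have the function 𝔯_D²/2, which reduces the claim to basic blocks. The rows are p-positive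
-- by the Newton identity. For tₙ = 𝔯_{△ₙ,₃} = q₂ qₙ₋₂ − q₁ qₙ₋₁ + qₙ it becomes
-- n tₙ = q₁ q₂ qₙ₋₃ + Σ_{k ≥ 3 odd} 2 pₖ tₙ₋ₖ, again with nonnegative coefficients.
module Submission where

open import Defs
open import Algebra using (CommutativeRing; CommutativeSemiring)
import Algebra.Properties.CommutativeMonoid.Mult as CMMult
open import Algebra.Properties.Group using (∙-cancelʳ)
import Algebra.Properties.Semiring.Mult as SRMult
import Algebra.Solver.Ring.NaturalCoefficients.Default as SemiringSolver
open import Data.Bool using (Bool; true; false; T; _∧_; not; if_then_else_)
import Data.Bool.Properties as Boolₚ
open import Data.Empty using (⊥-elim)
open import Data.Fin as Fin using (Fin; toℕ)
import Data.Fin.Properties as Finₚ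
open import Data.Integer as ℤ using (ℤ; +_)
import Data.Integer.Properties as ℤₚ
open import Data.Integer.Tactic.RingSolver using (solve-∀)
open import Data.List using (List; []; _∷_; _++_; allFin; applyUpTo; cartesianProduct; concatMap; filterᵇ;
  foldr; length; map; replicate; reverse; upTo; zip)
open import Data.List.Membership.Propositional using (_∈_)
import Data.List.Properties as Listₚ
open import Data.List.Relation.Binary.Permutation.Propositional as Perm using (_↭_)
open import Data.List.Relation.Binary.Permutation.Propositional.Properties using (↭-reverse)
open import Data.List.Relation.Unary.All as All using (All; []; _∷_)
import Data.List.Relation.Unary.All.Properties as Allₚ
open import Data.List.Relation.Unary.AllPairs using (AllPairs; []; _∷_)
import Data.List.Relation.Unary.AllPairs.Properties as AllPairsₚ
open import Data.List.Relation.Unary.Any using (here; there)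
import Data.List.Relation.Unary.Any.Properties as Anyₚ
open import Data.Nat as ℕ using (ℕ; zero; suc; _∸_; _≤_; _<_; z≤n; s≤s)
open import Data.Nat.Induction using (<-rec)
import Data.Nat.Properties as ℕₚ
open import Data.Product using (Σ; _×_; _,_; proj₁; proj₂)
open import Data.Rational as ℚ using (ℚ; 0ℚ; 1ℚ)
import Data.Rational.Properties as ℚₚ
import Data.Rational.Unnormalised as ℚᵘ
import Data.Rational.Unnormalised.Properties as ℚᵘₚ
open import Data.Sum using (_⊎_; inj₁; inj₂)
open import Data.Vec as Vec using (Vec; lookup; tabulate)
import Data.Vec.Properties as Vecₚ
open import Function using (_∘_; flip)
open import Level using (0ℓ)
open import Relation.Binary.Definitions using (tri<; tri≈; tri>)
open import Relation.Binary.PropositionalEquality as ≡ using (_≡_)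
open import Relation.Binary.Structures using (IsEquivalence)
open import Relation.Nullary using (¬_; yes; no; contradiction)
open import Relation.Nullary.Decidable using (dec-true; dec-false)

-- Formal power series over a commutative semiring

-- The blocks `△ₙ,₃` are positive because of a truncated exponential. With `u = q₁ = 2 p₁` the
-- Newton identity means `Q = Σ qₙ tⁿ = exp (u t) · exp (Σ 2 pₖ tᵏ / k)`, the inner sum over odd `k
-- ≥ 3`. As `q₂ = u² / 2`, the series of the `tₙ` is `(1 - u t + u² t² / 2)
-- Q`, and its polynomial factor truncates `exp (- u t)`. Hence the derivative of `(1 - u t + u² t²
-- / 2) exp (u t)` collapses to `u³ t² / 2 · exp (u t)`, with a positive sign because the truncation
-- stops at an even degree. Signs are the obstacle elsewhere: ribbon functions are alternating sums
-- of products of rows, while positive combinations are closed only under sums, products and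
-- positive scalars. Identities are therefore written with all negative terms moved to the other
-- side and proved in a commutative semiring. Cancellation of summands and of integer factors is
-- assumed where it is used; polynomials inherit both from ℚ. One expansion has to serve all numbers
-- `m` of variables, so positivity is propagated for families indexed by `m`.

module Sums (R : CommutativeSemiring 0ℓ 0ℓ) where
  open CommutativeSemiring R
  open SemiringSolver R using (solve; _:+_; _:=_)
  open import Relation.Binary.Reasoning.Setoid setoid

  ∑ : {A : Set} → List A → (A → Carrier) → Carrier
  ∑ []       f = 0#
  ∑ (x ∷ xs) f = f x + ∑ xs f

  infix 7 [_]·_

  [_]·_ : Bool → Carrier → Carrier
  [ b ]· x = if b then x else 0#

  []·-cong : ∀ b {x y} → x ≈ y → [ b ]· x ≈ [ b ]· y
  []·-cong true  e = e
  []·-cong false e = refl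

  []·-split : ∀ b x → x ≈ [ b ]· x + [ not b ]· x
  []·-split true  x = sym (+-identityʳ x)
  []·-split false x = sym (+-identityˡ x)

  []·-*ʳ : ∀ b x y → ([ b ]· x) * y ≈ [ b ]· (x * y)
  []·-*ʳ true  x y = refl
  []·-*ʳ false x y = zeroˡ y

  []·-+ : ∀ b x y → [ b ]· (x + y) ≈ [ b ]· x + [ b ]· y
  []·-+ true  x y = refl
  []·-+ false x y = sym (+-identityˡ 0#)

  []·-∧ : ∀ b c x → [ b ∧ c ]· x ≈ [ b ]· ([ c ]· x)
  []·-∧ true  c x = refl
  []·-∧ false c x = refl

  module _ {A : Set} where

    ∑-congᴬ : ∀ {xs : List A} {f g} → All (λ x → f x ≈ g x) xs → ∑ xs f ≈ ∑ xs g
    ∑-congᴬ []       = refl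
    ∑-congᴬ (e ∷ es) = +-cong e (∑-congᴬ es)

    ∑-cong : ∀ (xs : List A) {f g} → (∀ x → f x ≈ g x) → ∑ xs f ≈ ∑ xs g
    ∑-cong xs e = ∑-congᴬ (All.universal e xs)

    ∑-0 : ∀ (xs : List A) → ∑ xs (λ _ → 0#) ≈ 0#
    ∑-0 []       = refl
    ∑-0 (x ∷ xs) = trans (+-identityˡ _) (∑-0 xs)

    ∑-+ : ∀ (xs : List A) f g → ∑ xs (λ x → f x + g x) ≈ ∑ xs f + ∑ xs g
    ∑-+ []       f g = sym (+-identityˡ 0#)
    ∑-+ (x ∷ xs) f g = trans (+-congˡ (∑-+ xs f g))
      (solve 4 (λ a b c d → (a :+ b) :+ (c :+ d) := (a :+ c) :+ (b :+ d)) refl _ _ _ _)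

    ∑-*ʳ : ∀ (xs : List A) f a → ∑ xs f * a ≈ ∑ xs (λ x → f x * a)
    ∑-*ʳ []       f a = zeroˡ a
    ∑-*ʳ (x ∷ xs) f a = trans (distribʳ a _ _) (+-congˡ (∑-*ʳ xs f a))

    ∑-*ˡ : ∀ (xs : List A) f a → a * ∑ xs f ≈ ∑ xs (λ x → a * f x)
    ∑-*ˡ []       f a = zeroʳ a
    ∑-*ˡ (x ∷ xs) f a = trans (distribˡ a _ _) (+-congˡ (∑-*ˡ xs f a))

    ∑-++ : ∀ (xs ys : List A) f → ∑ (xs ++ ys) f ≈ ∑ xs f + ∑ ys f
    ∑-++ []       ys f = sym (+-identityˡ _)
    ∑-++ (x ∷ xs) ys f = trans (+-congˡ (∑-++ xs ys f)) (sym (+-assoc _ _ _))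

    ∑-↭ : ∀ {xs ys : List A} f → xs ↭ ys → ∑ xs f ≈ ∑ ys f
    ∑-↭ f Perm.refl = refl
    ∑-↭ f (Perm.prep x p) = +-congˡ (∑-↭ f p)
    ∑-↭ f (Perm.swap x y p) = trans (+-congˡ (+-congˡ (∑-↭ f p)))
      (solve 3 (λ a b c → a :+ (b :+ c) := b :+ (a :+ c)) refl _ _ _)
    ∑-↭ f (Perm.trans p q) = trans (∑-↭ f p) (∑-↭ f q)

    ∑-map : ∀ {B : Set} (h : B → A) xs f → ∑ (map h xs) f ≈ ∑ xs (f ∘ h)
    ∑-map h []       f = refl
    ∑-map h (x ∷ xs) f = +-congˡ (∑-map h xs f)

    ∑-concatMap : ∀ {B : Set} (h : B → List A) xs f →
                  ∑ (concatMap h xs) f ≈ ∑ xs (λ x → ∑ (h x) f)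
    ∑-concatMap h []       f = refl
    ∑-concatMap h (x ∷ xs) f = trans (∑-++ (h x) _ f) (+-congˡ (∑-concatMap h xs f))

    []·-∑ : ∀ b (xs : List A) f → [ b ]· ∑ xs f ≈ ∑ xs (λ x → [ b ]· f x)
    []·-∑ true  xs f = refl
    []·-∑ false xs f = sym (∑-0 xs)

  ∑-swap : ∀ {A B : Set} (xs : List A) (ys : List B) (f : A → B → Carrier) →
           ∑ xs (λ x → ∑ ys (f x)) ≈ ∑ ys (λ y → ∑ xs (λ x → f x y))
  ∑-swap []       ys f = sym (∑-0 ys)
  ∑-swap (x ∷ xs) ys f = trans (+-congˡ (∑-swap xs ys f)) (sym (∑-+ ys (f x) _))

-- Convolution, the Euler derivation and the effect of one more variable

module Streams (R : CommutativeSemiring 0ℓ 0ℓ) where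
  open CommutativeSemiring R
  open Sums R
  open SRMult semiring using (×-comm-*; ×-congʳ) renaming (_×_ to _×ₙ_)
  open CMMult +-commutativeMonoid using (×-distrib-+)
  open SemiringSolver R using (solve; _:+_; _:*_; _:=_; con)
  open import Relation.Binary.Reasoning.Setoid setoid

  Stream : Set
  Stream = ℕ → Carrier

  infix 4 _≐_
  _≐_ : Stream → Stream → Set
  f ≐ g = ∀ n → f n ≈ g n

  shift : Stream → Stream
  shift f zero    = 0#
  shift f (suc n) = f n

  conv : Stream → Stream → Stream
  conv f g zero    = f 0 * g 0
  conv f g (suc n) = f 0 * g (suc n) + conv (f ∘ suc) g n

  -- the Euler derivation t·d/dt of the power series Σ fₙ tⁿ
  euler : Stream → Stream
  euler f n = n ×ₙ f n

  shift-cong : ∀ {f g} → f ≐ g → shift f ≐ shift g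
  shift-cong e zero    = refl
  shift-cong e (suc n) = e n

  -- The Leibniz rule for a product with `t`, since `shift` is multiplication by `t`.
  euler-shift : ∀ f n → euler (shift f) n ≈ shift (euler f) n + shift f n
  euler-shift f zero    = sym (+-identityˡ 0#)
  euler-shift f (suc n) = +-comm _ _

  conv-congˡ : ∀ {f f′} g → f ≐ f′ → conv f g ≐ conv f′ g
  conv-congˡ g e zero    = *-congʳ (e 0)
  conv-congˡ g e (suc n) = +-cong (*-congʳ (e 0)) (conv-congˡ g (e ∘ suc) n)

  conv-cong-≤ : ∀ f {g g′} n → (∀ j → j ≤ n → g j ≈ g′ j) → conv f g n ≈ conv f g′ n
  conv-cong-≤ f zero    e = *-congˡ (e 0 z≤n)
  conv-cong-≤ f (suc n) e = +-cong (*-congˡ (e (suc n) ℕₚ.≤-refl))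
    (conv-cong-≤ (f ∘ suc) n (λ j j≤n → e j (ℕₚ.m≤n⇒m≤1+n j≤n)))

  conv-congʳ : ∀ f {g g′} → g ≐ g′ → conv f g ≐ conv f g′
  conv-congʳ f e n = conv-cong-≤ f n (λ j _ → e j)

  -- A factor without constant term never meets the coefficient `g n` itself. This turns a Newton
  -- identity into a recursion and makes strong induction on `n` possible.
  conv-cong-< : ∀ f {g g′} n → f 0 ≈ 0# → (∀ j → j < n → g j ≈ g′ j) →
                conv f g n ≈ conv f g′ n
  conv-cong-< f zero    f0 e = trans (*-congʳ f0) (trans (zeroˡ _) (sym (trans (*-congʳ f0) (zeroˡ _))))
  conv-cong-< f (suc n) f0 e = +-cong
    (trans (*-congʳ f0) (trans (zeroˡ _) (sym (trans (*-congʳ f0) (zeroˡ _)))))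
    (conv-cong-≤ (f ∘ suc) n (λ j j≤n → e j (s≤s j≤n)))

  conv-+ˡ : ∀ f f′ g n → conv (λ k → f k + f′ k) g n ≈ conv f g n + conv f′ g n
  conv-+ˡ f f′ g zero    = distribʳ _ _ _
  conv-+ˡ f f′ g (suc n) = trans (+-congˡ (conv-+ˡ (f ∘ suc) (f′ ∘ suc) g n))
    (solve 5 (λ a b c x y → (a :+ b) :* c :+ (x :+ y) := (a :* c :+ x) :+ (b :* c :+ y)) refl _ _ _ _ _)

  conv-+ʳ : ∀ f g g′ n → conv f (λ k → g k + g′ k) n ≈ conv f g n + conv f g′ n
  conv-+ʳ f g g′ zero    = distribˡ _ _ _
  conv-+ʳ f g g′ (suc n) = trans (+-congˡ (conv-+ʳ (f ∘ suc) g g′ n))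
    (solve 5 (λ a b c x y → a :* (b :+ c) :+ (x :+ y) := (a :* b :+ x) :+ (a :* c :+ y)) refl _ _ _ _ _)

  conv-*ʳ : ∀ f a g n → conv f (λ k → a * g k) n ≈ a * conv f g n
  conv-*ʳ f a g zero    = solve 3 (λ x a y → x :* (a :* y) := a :* (x :* y)) refl _ _ _
  conv-*ʳ f a g (suc n) = trans (+-congˡ (conv-*ʳ (f ∘ suc) a g n))
    (solve 4 (λ x a y z → x :* (a :* y) :+ a :* z := a :* (x :* y :+ z)) refl _ _ _ _)

  conv-shiftʳ : ∀ f g → conv f (shift g) ≐ shift (conv f g)
  conv-shiftʳ f g zero          = zeroʳ _
  conv-shiftʳ f g (suc zero)    = trans (+-congˡ (zeroʳ _)) (+-identityʳ _)
  conv-shiftʳ f g (suc (suc n)) = +-congˡ (conv-shiftʳ (f ∘ suc) g (suc n))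

  conv-zeroˡ : ∀ {f} g → (∀ k → f k ≈ 0#) → ∀ n → conv f g n ≈ 0#
  conv-zeroˡ g e zero    = trans (*-congʳ (e 0)) (zeroˡ _)
  conv-zeroˡ g e (suc n) = trans (+-cong (trans (*-congʳ (e 0)) (zeroˡ _)) (conv-zeroˡ g (e ∘ suc) n))
                                 (+-identityˡ 0#)

  -- t·(d/dt) log ((1 + x t) / (1 - x t)) = 2 (x t + x³ t³ + x⁵ t⁵ + ⋯)
  oddPowers : Carrier → Stream
  oddPowers x 0             = 0#
  oddPowers x 1             = x + x
  oddPowers x (suc (suc k)) = x * (x * oddPowers x k)

  -- In terms of the usual power sums this is `2 pₖ` for odd `k` and `0` for even `k`.
  powerSums : {V : Set} → (V → Carrier) → List V → Stream
  powerSums x vs k = ∑ vs (λ v → oddPowers (x v) k)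

  -- H = F · (1 + x t) / (1 - x t) as power series
  record Extends (x : Carrier) (F H : Stream) : Set where
    field
      F₀   : F 0 ≈ 1#
      H₀   : H 0 ≈ 1#
      step : ∀ n → H (suc n) ≈ F (suc n) + x * F n + x * H n

  module _ {x F H} (ext : Extends x F H) where
    open Extends ext

    -- Let `O = 2 x t / (1 - x² t²)` be the series of `oddPowers x`. In
    -- `(1 - x t) O H = x t (F + H)` both sides equal `2 x t F / (1 - x t)`; the lemma is this
    -- equation read off at degree `n + 1`, free of subtraction.
    oddPowers-conv : ∀ n → conv (oddPowers x) H (suc n) ≈ x * (conv (oddPowers x) H n + F n + H n)
    oddPowers-conv zero = begin
      0# * H 1 + (x + x) * H 0             ≈⟨ +-congˡ (*-congˡ H₀) ⟩
      0# * H 1 + (x + x) * 1#              ≈⟨ solve 3 (λ x h k → con 0 :* h :+ (x :+ x) :* con 1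
                                                := x :* ((con 0 :* k :+ con 1) :+ con 1)) refl x _ _ ⟩
      x * (0# * H 0 + 1# + 1#)             ≈⟨ *-congˡ (+-cong (+-congˡ F₀) H₀) ⟨
      x * (0# * H 0 + F 0 + H 0)           ∎
    oddPowers-conv (suc n) = begin
      conv P H (2 ℕ.+ n)                        ≈⟨ unfold n ⟩
      (x + x) * H (suc n) + x * (x * conv P H n)
        ≈⟨ solve 3 (λ x h y → (x :+ x) :* h :+ x :* (x :* y) := x :* h :+ (x :* (x :* y) :+ x :* h)) refl _ _ _ ⟩
      x * H (suc n) + (x * (x * conv P H n) + x * H (suc n))
        ≈⟨ +-congˡ (+-congˡ (*-congˡ (step n))) ⟩
      x * H (suc n) + (x * (x * conv P H n) + x * (F (suc n) + x * F n + x * H n))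
        ≈⟨ solve 6 (λ x h y f f₁ g → x :* h :+ (x :* (x :* y) :+ x :* (f₁ :+ x :* f :+ x :* g))
                        := x :* (x :* (y :+ f :+ g) :+ f₁ :+ h)) refl _ _ _ _ _ _ ⟩
      x * (x * (conv P H n + F n + H n) + F (suc n) + H (suc n))
        ≈⟨ *-congˡ (+-congʳ (+-congʳ (oddPowers-conv n))) ⟨
      x * (conv P H (suc n) + F (suc n) + H (suc n)) ∎
      where
      P = oddPowers x
      scale : ∀ a f g n → conv (λ k → a * (a * f k)) g n ≈ a * (a * conv f g n)
      scale a f g zero    = solve 3 (λ a f g → a :* (a :* f) :* g := a :* (a :* (f :* g))) refl _ _ _
      scale a f g (suc n) = trans (+-congˡ (scale a (f ∘ suc) g n))
        (solve 4 (λ a f g y → a :* (a :* f) :* g :+ a :* (a :* y) := a :* (a :* (f :* g :+ y))) refl _ _ _ _)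
      unfold : ∀ n → conv P H (2 ℕ.+ n) ≈ (x + x) * H (suc n) + x * (x * conv P H n)
      unfold n = trans (+-cong (zeroˡ _) (+-congˡ (scale x P H n))) (+-identityˡ _)

    -- Logarithmic derivatives of a product add up, and the new factor `(1 + x t) / (1 - x t)`
    -- contributes `oddPowers x`. Instead of dividing by `1 - x t`, the proof differentiates the
    -- recursion `step` and uses induction on the degree.
    newton-step : ∀ {P} → euler F ≐ conv P F → euler H ≐ conv (λ k → oddPowers x k + P k) H
    newton-step {P} dF zero = sym (begin
      (0# + P 0) * H 0   ≈⟨ *-cong (+-identityˡ _) (trans H₀ (sym F₀)) ⟩
      P 0 * F 0          ≈⟨ dF 0 ⟨
      0#                 ∎)
    newton-step {P} dF (suc n) = begin
      suc n ×ₙ H (suc n)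
        ≈⟨ ×-congʳ (suc n) (step n) ⟩
      suc n ×ₙ (F (suc n) + x * F n + x * H n)
        ≈⟨ trans (×-distrib-+ _ _ (suc n)) (+-congʳ (×-distrib-+ _ _ (suc n))) ⟩
      suc n ×ₙ F (suc n) + suc n ×ₙ (x * F n) + suc n ×ₙ (x * H n)
        ≈⟨ +-cong (+-cong (dF (suc n)) (sym (×-comm-* (suc n) x _))) (sym (×-comm-* (suc n) x _)) ⟩
      conv P F (suc n) + x * (F n + n ×ₙ F n) + x * (H n + n ×ₙ H n)
        ≈⟨ +-cong (+-congˡ (*-congˡ (+-congˡ (dF n)))) (*-congˡ (+-congˡ (trans (newton-step dF n) (conv-+ˡ O P H n)))) ⟩
      conv P F (suc n) + x * (F n + conv P F n) + x * (H n + (conv O H n + conv P H n))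
        ≈⟨ solve 7 (λ x a f b h c d → a :+ x :* (f :+ b) :+ x :* (h :+ (c :+ d))
              := x :* (c :+ f :+ h) :+ (a :+ x :* b :+ x :* d)) refl _ _ _ _ _ _ _ ⟩
      x * (conv O H n + F n + H n) + (conv P F (suc n) + x * conv P F n + x * conv P H n)
        ≈⟨ +-cong (oddPowers-conv n) (expand n) ⟨
      conv O H (suc n) + conv P H (suc n)
        ≈⟨ conv-+ˡ O P H (suc n) ⟨
      conv (λ k → O k + P k) H (suc n) ∎
      where
      O = oddPowers x
      -- The recursion `step` as an equation of whole series, to which `conv P` can be applied. At
      -- degree 0 it holds because `F` and `H` both start with 1.
      H′ : Stream
      H′ n = F n + x * shift F n + x * shift H n
      H≐H′ : H ≐ H′
      H≐H′ zero    = begin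
        H 0                      ≈⟨ trans H₀ (sym F₀) ⟩
        F 0                      ≈⟨ solve 2 (λ f x → f := f :+ x :* con 0 :+ x :* con 0) refl _ x ⟩
        F 0 + x * 0# + x * 0#    ∎
      H≐H′ (suc n) = step n
      expand : ∀ n → conv P H (suc n) ≈ conv P F (suc n) + x * conv P F n + x * conv P H n
      expand n = begin
        conv P H (suc n)
          ≈⟨ conv-congʳ P H≐H′ (suc n) ⟩
        conv P H′ (suc n)
          ≈⟨ trans (conv-+ʳ P _ _ (suc n)) (+-congʳ (conv-+ʳ P _ _ (suc n))) ⟩
        conv P F (suc n) + conv P (λ k → x * shift F k) (suc n) + conv P (λ k → x * shift H k) (suc n)
          ≈⟨ +-cong (+-congˡ (conv-*ʳ P x _ (suc n))) (conv-*ʳ P x _ (suc n)) ⟩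
        conv P F (suc n) + x * conv P (shift F) (suc n) + x * conv P (shift H) (suc n)
          ≈⟨ +-cong (+-congˡ (*-congˡ (conv-shiftʳ P F (suc n)))) (*-congˡ (conv-shiftʳ P H (suc n))) ⟩
        conv P F (suc n) + x * conv P F n + x * conv P H n ∎

-- Ribbons as words

-- The word of a ribbon lists its steps from the top right box to the bottom left one:
-- true is a step to the left, false is a step down.
Word : Set
Word = List Bool

-- Transposing a ribbon reverses its word and negates the steps, a half turn only reverses it.
image : Bool → Bool → Bool
image t s = if t then not s else s

module Ribbons (R : CommutativeSemiring 0ℓ 0ℓ) {V : Set}
  (x : V → CommutativeSemiring.Carrier R) (vs : List V)
  (canFollow : Bool → V × Bool → V → Bool)
  (canFollow-not : ∀ l v → canFollow false l v ≡ not (canFollow true l v)) where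

  open CommutativeSemiring R
  open Sums R
  open Streams R
  open SRMult semiring using () renaming (_×_ to _×ₙ_)
  open SemiringSolver R using (solve; _:+_; _:*_; _:=_; con)
  open import Relation.Binary.Reasoning.Setoid setoid

  -- `after w l` sums over the fillings of the boxes that the steps `w` add behind a box with letter
  -- `l`. `from w v` sums over the fillings of the whole ribbon whose first box has value `v`, with
  -- either mark.
  after : Word → V × Bool → Carrier
  from  : Word → V → Carrier
  after []      l = 1#
  after (s ∷ w) l = ∑ vs (λ v → [ canFollow s l v ]· (x v * (after w (v , true) + after w (v , false))))
  from w v = x v * (after w (v , true) + after w (v , false))

  ⟪_⟫ : Word → Carrier
  ⟪ w ⟫ = ∑ vs (from w)

  ⟪⟫-cong : ∀ {u w} → u ≡ w → ⟪ u ⟫ ≈ ⟪ w ⟫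
  ⟪⟫-cong e = reflexive (≡.cong ⟪_⟫ e)

  after-* : ∀ u w l → after u l * ⟪ w ⟫ ≈ after (u ++ true ∷ w) l + after (u ++ false ∷ w) l
  from-*  : ∀ u w v → from u v * ⟪ w ⟫ ≈ from (u ++ true ∷ w) v + from (u ++ false ∷ w) v

  after-* [] w l = begin
    1# * ⟪ w ⟫     ≈⟨ *-identityˡ _ ⟩
    ⟪ w ⟫          ≈⟨ ∑-cong vs (λ v → trans ([]·-split (canFollow true l v) _)
                        (+-congˡ (reflexive (≡.cong ([_]· _) (≡.sym (canFollow-not l v)))))) ⟩
    ∑ vs (λ v → [ canFollow true l v ]· from w v + [ canFollow false l v ]· from w v)
                   ≈⟨ ∑-+ vs _ _ ⟩
    after (true ∷ w) l + after (false ∷ w) l ∎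
  after-* (s ∷ u) w l = begin
    ∑ vs (λ v → [ canFollow s l v ]· from u v) * ⟪ w ⟫
      ≈⟨ ∑-*ʳ vs _ _ ⟩
    ∑ vs (λ v → ([ canFollow s l v ]· from u v) * ⟪ w ⟫)
      ≈⟨ ∑-cong vs (λ v → trans ([]·-*ʳ (canFollow s l v) _ _)
           (trans ([]·-cong (canFollow s l v) (from-* u w v)) ([]·-+ (canFollow s l v) _ _))) ⟩
    ∑ vs (λ v → [ canFollow s l v ]· from (u ++ true ∷ w) v + [ canFollow s l v ]· from (u ++ false ∷ w) v)
      ≈⟨ ∑-+ vs _ _ ⟩
    after (s ∷ u ++ true ∷ w) l + after (s ∷ u ++ false ∷ w) l ∎

  from-* u w v = begin
    x v * (after u (v , true) + after u (v , false)) * ⟪ w ⟫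
      ≈⟨ solve 4 (λ x a b c → x :* (a :+ b) :* c := x :* (a :* c :+ b :* c)) refl _ _ _ _ ⟩
    x v * (after u (v , true) * ⟪ w ⟫ + after u (v , false) * ⟪ w ⟫)
      ≈⟨ *-congˡ (+-cong (after-* u w _) (after-* u w _)) ⟩
    x v * ((after (u ++ true ∷ w) (v , true) + after (u ++ false ∷ w) (v , true)) +
           (after (u ++ true ∷ w) (v , false) + after (u ++ false ∷ w) (v , false)))
      ≈⟨ solve 5 (λ x a b c d → x :* ((a :+ b) :+ (c :+ d)) := x :* (a :+ c) :+ x :* (b :+ d)) refl _ _ _ _ _ ⟩
    from (u ++ true ∷ w) v + from (u ++ false ∷ w) v ∎

  -- The step inserted between the two words is `true` for near concatenation and `false` for
  -- concatenation.
  ⟪⟫-* : ∀ u w → ⟪ u ⟫ * ⟪ w ⟫ ≈ ⟪ u ++ true ∷ w ⟫ + ⟪ u ++ false ∷ w ⟫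
  ⟪⟫-* u w = begin
    ⟪ u ⟫ * ⟪ w ⟫                                    ≈⟨ ∑-*ʳ vs _ _ ⟩
    ∑ vs (λ v → from u v * ⟪ w ⟫)                    ≈⟨ ∑-cong vs (from-* u w) ⟩
    ∑ vs (λ v → from (u ++ true ∷ w) v + from (u ++ false ∷ w) v) ≈⟨ ∑-+ vs _ _ ⟩
    ⟪ u ++ true ∷ w ⟫ + ⟪ u ++ false ∷ w ⟫ ∎

  -- A word of `n` steps has `n + 1` boxes, hence the offset. Index 0 stands for the empty ribbon.
  straight : Bool → Stream
  straight s zero    = 1#
  straight s (suc n) = ⟪ replicate n s ⟫

  -- In the direction s the letter of v that may be repeated is the one with mark not s.
  record Sorted (s : Bool) (us : List V) : Set where
    field
      perm    : us ↭ vs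
      repeats : ∀ v → canFollow s (v , not s) v ≡ true
      stops   : ∀ v → canFollow s (v , s) v ≡ false
      ordered : AllPairs (λ v u → ∀ mk → canFollow s (v , mk) u ≡ true × canFollow s (u , mk) v ≡ false) us

  -- The Newton identity for rows and columns

  module _ {s us} (sorted : Sorted s us) where
    open Sorted sorted

    private
      -- Only the first value is explicitly restricted to `A`, because `from` sums over all of `vs`.
      -- When every value of `A` is `Closed`, the later values stay in `A` as well, and this is the
      -- function of straight ribbons in the variables of `A`.
      chains : List V → Stream
      chains A zero    = 1#
      chains A (suc n) = ∑ A (from (replicate n s))

      Order : V → V → Set
      Order v u = ∀ mk → canFollow s (v , mk) u ≡ true × canFollow s (u , mk) v ≡ false

      Closed : List V → V → Set
      Closed A v = ∀ mk (g : V → Carrier) →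
        ∑ vs (λ u → [ canFollow s (v , mk) u ]· g u) ≈ ∑ A (λ u → [ canFollow s (v , mk) u ]· g u)

      guard : ∀ {b c} → b ≡ c → ∀ y → [ b ]· y ≈ [ c ]· y
      guard ≡.refl y = refl

      -- The repeatable letter of the first value `v` can be followed by any chain in `v ∷ A`, the
      -- other letter of `v` only by chains in `A`. The two cases are the terms `x * H n` and
      -- `x * F n` of `Extends`.
      after-repeats : ∀ {v A} → All (Order v) A → Closed (v ∷ A) v →
                      ∀ n → after (replicate n s) (v , not s) ≈ chains (v ∷ A) n
      after-repeats o c zero    = refl
      after-repeats {v} o c (suc n) = trans (c (not s) (from (replicate n s)))
        (+-cong (guard (repeats v) _) (∑-congᴬ (All.map (λ p → guard (proj₁ (p (not s))) _) o)))

      after-stops : ∀ {v A} → All (Order v) A → Closed (v ∷ A) v →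
                    ∀ n → after (replicate n s) (v , s) ≈ chains A n
      after-stops o c zero    = refl
      after-stops {v} o c (suc n) = trans (c s (from (replicate n s)))
        (trans (+-cong (guard (stops v) _) (∑-congᴬ (All.map (λ p → guard (proj₁ (p s)) _) o)))
               (+-identityˡ _))

      newton-chains : ∀ A → AllPairs Order A → All (Closed A) A →
                      euler (chains A) ≐ conv (powerSums x A) (chains A)
      newton-chains [] [] [] n = trans (zeros n) (sym (conv-zeroˡ {powerSums x []} _ (λ _ → refl) n))
        where
        ×-0 : ∀ n → n ×ₙ 0# ≈ 0#
        ×-0 zero    = refl
        ×-0 (suc n) = trans (+-identityˡ _) (×-0 n)
        zeros : ∀ n → n ×ₙ chains [] n ≈ 0#
        zeros zero    = refl
        zeros (suc n) = ×-0 (suc n)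
      newton-chains (v ∷ A) (o ∷ os) (c ∷ cs) =
        newton-step ext (newton-chains A os (All.zipWith restrict (o , cs)))
        where
        -- Removing `v` keeps the later values closed, since none of them can be followed by `v`.
        restrict : ∀ {u} → Order v u × Closed (v ∷ A) u → Closed A u
        restrict (p , d) mk g = trans (d mk g) (trans (+-congʳ (guard (proj₂ (p mk)) _)) (+-identityˡ _))
        pair : ∀ s {f : Bool → Carrier} {a b} → f s ≈ a → f (not s) ≈ b → f true + f false ≈ a + b
        pair true  p q = +-cong p q
        pair false p q = trans (+-comm _ _) (+-cong p q)
        ext : Extends (x v) (chains A) (chains (v ∷ A))
        ext = record { F₀ = refl ; H₀ = refl ; step = λ n → trans
          (+-congʳ (*-congˡ (pair s {λ mk → after (replicate n s) (v , mk)} (after-stops o c n) (after-repeats o c n))))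
          (solve 4 (λ a x f h → x :* (f :+ h) :+ a := a :+ x :* f :+ x :* h) refl _ _ _ _) }

    newton : euler (straight s) ≐ conv (powerSums x vs) (straight s)
    newton n = begin
      euler (straight s) n                  ≈⟨ SRMult.×-congʳ semiring n (chains≐straight n) ⟨
      euler (chains us) n                   ≈⟨ newton-chains us ordered
                                                 (All.universal (λ v mk g → ∑-↭ _ (Perm.↭-sym perm)) us) n ⟩
      conv (powerSums x us) (chains us) n   ≈⟨ conv-congˡ _ (λ k → ∑-↭ _ perm) n ⟩
      conv (powerSums x vs) (chains us) n   ≈⟨ conv-congʳ (powerSums x vs) chains≐straight n ⟩
      conv (powerSums x vs) (straight s) n  ∎
      where
      chains≐straight : chains us ≐ straight s
      chains≐straight zero    = refl
      chains≐straight (suc n) = ∑-↭ _ perm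

  -- Symmetries of ribbon functions and the recursion for triangles

  module Identities
    (cancelʳ : ∀ a {b c} → b + a ≈ c + a → b ≈ c)
    (torsionFree : ∀ n {a b} → suc n ×ₙ a ≈ suc n ×ₙ b → a ≈ b)
    {left down : List V} (sortedˡ : Sorted true left) (sortedᵈ : Sorted false down) where

    private
      P : Stream
      P = powerSums x vs
      q : Stream
      q = straight true
      -- `u` is `2 p₁`, which equals `q 1` by `straight₁`, and `h` plays the role of `u² / 2` by
      -- `straight₂`.
      u : Carrier
      u = P 1
      h : Carrier
      h = q 2

      P₀≈0 : P 0 ≈ 0#
      P₀≈0 = ∑-0 vs

      P₂≈0 : P 2 ≈ 0#
      P₂≈0 = trans (∑-cong vs (λ v → trans (*-congˡ (zeroʳ _)) (zeroʳ _))) (∑-0 vs)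

    straight-≐ : straight true ≐ straight false
    straight-≐ = <-rec _ go
      where
      go : ∀ n → (∀ {j} → j < n → straight true j ≈ straight false j) → straight true n ≈ straight false n
      go zero    rec = refl
      go (suc n) rec = torsionFree n (trans (newton sortedˡ (suc n))
        (trans (conv-cong-< P (suc n) P₀≈0 (λ j j<n → rec j<n)) (sym (newton sortedᵈ (suc n)))))

    row≈column : ∀ n → ⟪ replicate n true ⟫ ≈ ⟪ replicate n false ⟫
    row≈column n = straight-≐ (suc n)

    private
      replicate-∷ʳ : ∀ (s : Bool) n (w : Word) → replicate n s ++ s ∷ w ≡ s ∷ replicate n s ++ w
      replicate-∷ʳ s zero    w = ≡.refl
      replicate-∷ʳ s (suc n) w = ≡.cong (s ∷_) (replicate-∷ʳ s n w)

      reverse-∷-++ : ∀ (s : Bool) w t → reverse (s ∷ w) ++ t ≡ reverse w ++ s ∷ t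
      reverse-∷-++ s w t = ≡.trans (≡.cong (_++ t) (Listₚ.unfold-reverse s w))
                                   (Listₚ.++-assoc (reverse w) (s ∷ []) t)

      row≈image : ∀ t n → ⟪ replicate n true ⟫ ≈ ⟪ replicate n (image t true) ⟫
      row≈image true  n = row≈column n
      row≈image false n = refl

      ⟪⟫-*-image : ∀ t u w → ⟪ u ⟫ * ⟪ w ⟫ ≈ ⟪ u ++ image t false ∷ w ⟫ + ⟪ u ++ image t true ∷ w ⟫
      ⟪⟫-*-image true  u w = ⟪⟫-* u w
      ⟪⟫-*-image false u w = trans (⟪⟫-* u w) (+-comm _ _)

      -- Induction on `w` with a leading row split off. A left step only lengthens this row. A down
      -- step is removed by the product rule: concatenation is the product of the row and the rest
      -- minus their near concatenation. The product is handled by `row≈image` and the shorter word,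
      -- and the near concatenation is again a row followed by a shorter word, so it can be
      -- cancelled. This is why `n` must stay arbitrary.
      reverse-image-row : ∀ t w n → ⟪ replicate n true ++ w ⟫ ≈
        ⟪ reverse (map (image t) w) ++ replicate n (image t true) ⟫
      reverse-image-row t [] n = trans (⟪⟫-cong (Listₚ.++-identityʳ (replicate n true))) (row≈image t n)
      reverse-image-row t (true ∷ w) n = begin
        ⟪ replicate n true ++ true ∷ w ⟫            ≈⟨ ⟪⟫-cong (replicate-∷ʳ true n w) ⟩
        ⟪ replicate (suc n) true ++ w ⟫             ≈⟨ reverse-image-row t w (suc n) ⟩
        ⟪ reverse (map (image t) w) ++ replicate (suc n) (image t true) ⟫
          ≈⟨ ⟪⟫-cong (reverse-∷-++ (image t true) (map (image t) w) _) ⟨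
        ⟪ reverse (map (image t) (true ∷ w)) ++ replicate n (image t true) ⟫ ∎
      reverse-image-row t (false ∷ w) n = cancelʳ _ (begin
        ⟪ L ++ false ∷ w ⟫ + ⟪ L ++ true ∷ w ⟫      ≈⟨ +-comm _ _ ⟩
        ⟪ L ++ true ∷ w ⟫ + ⟪ L ++ false ∷ w ⟫      ≈⟨ ⟪⟫-* L w ⟨
        ⟪ L ⟫ * ⟪ w ⟫                               ≈⟨ *-comm _ _ ⟩
        ⟪ w ⟫ * ⟪ L ⟫                               ≈⟨ *-cong (trans (reverse-image-row t w 0)
                                                         (⟪⟫-cong (Listₚ.++-identityʳ (reverse (map (image t) w))))) (row≈image t n) ⟩
        ⟪ W ⟫ * ⟪ M ⟫                               ≈⟨ ⟪⟫-*-image t W M ⟩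
        ⟪ W ++ image t false ∷ M ⟫ + ⟪ W ++ image t true ∷ M ⟫
          ≈⟨ +-cong (⟪⟫-cong (reverse-∷-++ (image t false) (map (image t) w) M))
               (trans (⟪⟫-cong (replicate-∷ʳ true n w)) (reverse-image-row t w (suc n))) ⟨
        ⟪ reverse (map (image t) (false ∷ w)) ++ M ⟫ + ⟪ L ++ true ∷ w ⟫ ∎)
        where
        L M W : Word
        L = replicate n true
        M = replicate n (image t true)
        W = reverse (map (image t) w)

    ⟪⟫-reverse : ∀ t w → ⟪ reverse (map (image t) w) ⟫ ≈ ⟪ w ⟫
    ⟪⟫-reverse t w = sym (trans (reverse-image-row t w 0) (⟪⟫-cong (Listₚ.++-identityʳ (reverse (map (image t) w)))))

    doubling : ∀ s w → ⟪ w ++ s ∷ reverse (map not w) ⟫ + ⟪ w ++ s ∷ reverse (map not w) ⟫ ≈ ⟪ w ⟫ * ⟪ w ⟫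
    doubling s w = trans (halves s) (trans (sym (⟪⟫-* w wᵗ)) (*-congˡ (⟪⟫-reverse true w)))
      where
      wᵗ : Word
      wᵗ = reverse (map not w)
      wᵗᵗ : reverse (map not wᵗ) ≡ w
      wᵗᵗ = ≡.trans (≡.cong reverse (≡.trans (Listₚ.reverse-map not (map not w))
               (≡.cong reverse (≡.trans (≡.sym (Listₚ.map-∘ w)) (≡.trans (Listₚ.map-cong not² w) (Listₚ.map-id w))))))
             (Listₚ.reverse-involutive w)
        where
        not² : ∀ b → not (not b) ≡ b
        not² true  = ≡.refl
        not² false = ≡.refl
      swap : ⟪ w ++ true ∷ wᵗ ⟫ ≈ ⟪ w ++ false ∷ wᵗ ⟫
      swap = trans (sym (⟪⟫-reverse true (w ++ true ∷ wᵗ))) (⟪⟫-cong (≡.trans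
        (≡.cong reverse (Listₚ.map-++ not w (true ∷ wᵗ)))
        (≡.trans (Listₚ.reverse-++ (map not w) (false ∷ map not wᵗ))
        (≡.trans (reverse-∷-++ false (map not wᵗ) wᵗ) (≡.cong (_++ false ∷ wᵗ) wᵗᵗ)))))
      halves : ∀ s → ⟪ w ++ s ∷ wᵗ ⟫ + ⟪ w ++ s ∷ wᵗ ⟫ ≈ ⟪ w ++ true ∷ wᵗ ⟫ + ⟪ w ++ false ∷ wᵗ ⟫
      halves true  = +-congˡ swap
      halves false = +-congʳ (sym swap)

    straight₁ : q 1 ≈ P 1
    straight₁ = begin
      q 1                         ≈⟨ +-identityʳ _ ⟨
      1 ×ₙ q 1                    ≈⟨ newton sortedˡ 1 ⟩
      P 0 * q 1 + P 1 * 1#        ≈⟨ +-cong (trans (*-congʳ P₀≈0) (zeroˡ _)) (*-identityʳ _) ⟩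
      0# + P 1                    ≈⟨ +-identityˡ _ ⟩
      P 1                         ∎

    straight₂ : u * u ≈ h + h
    straight₂ = sym (begin
      h + h                                  ≈⟨ +-congˡ (+-identityʳ _) ⟨
      2 ×ₙ q 2                               ≈⟨ newton sortedˡ 2 ⟩
      P 0 * q 2 + (P 1 * q 1 + P 2 * 1#)     ≈⟨ +-cong (*-congʳ P₀≈0) (+-cong (*-congˡ straight₁) (*-congʳ P₂≈0)) ⟩
      0# * q 2 + (u * u + 0# * 1#)           ≈⟨ solve 2 (λ a b → con 0 :* a :+ (b :+ con 0 :* con 1) := b) refl _ _ ⟩
      u * u                                  ∎)

    -- ribbons △ₙ,₃, extended by the values that make △ₙ,₃ + q₁ qₙ₋₁ = q₂ qₙ₋₂ + qₙ true for all n
    tri₃ : Stream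
    tri₃ 0 = 1#
    tri₃ 1 = 0#
    tri₃ 2 = 0#
    tri₃ (suc (suc (suc k))) = ⟪ false ∷ false ∷ replicate k true ⟫

    -- P 2 vanishes, so the relevant terms start with k = 3.
    P≥₃ : Stream
    P≥₃ 0 = 0#
    P≥₃ 1 = 0#
    P≥₃ (suc (suc k)) = P (suc (suc k))

    private
      -- For `n ≥ 3` two products are compared: a single box times a row, and a column of two boxes
      -- times a row shorter by one. Both contain the ribbon with word `false ∷ true ∷ L`; besides
      -- it they contribute the long row and the triangle. The values of `tri₃` below 3 are chosen
      -- to fit, with `straight₂` giving the case 2.
      tri₃-relation : ∀ n → tri₃ n + u * shift q n ≈ q n + h * shift (shift q) n
      tri₃-relation 0 = solve 2 (λ u h → con 1 :+ u :* con 0 := con 1 :+ h :* con 0) refl u h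
      tri₃-relation 1 = begin
        0# + u * 1#      ≈⟨ solve 2 (λ u h → con 0 :+ u :* con 1 := u :+ h :* con 0) refl u h ⟩
        u + h * 0#       ≈⟨ +-congʳ straight₁ ⟨
        q 1 + h * 0#     ∎
      tri₃-relation 2 = begin
        0# + u * q 1     ≈⟨ trans (+-identityˡ _) (*-congˡ straight₁) ⟩
        u * u            ≈⟨ straight₂ ⟩
        h + h            ≈⟨ +-congˡ (*-identityʳ h) ⟨
        q 2 + h * 1#     ∎
      tri₃-relation (suc (suc (suc k))) = begin
        ⟪ false ∷ false ∷ L ⟫ + u * q (2 ℕ.+ k)
          ≈⟨ +-congˡ (*-congʳ (straight₁)) ⟨
        ⟪ false ∷ false ∷ L ⟫ + ⟪ [] ⟫ * ⟪ true ∷ L ⟫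
          ≈⟨ +-congˡ (⟪⟫-* [] (true ∷ L)) ⟩
        ⟪ false ∷ false ∷ L ⟫ + (⟪ true ∷ true ∷ L ⟫ + ⟪ false ∷ true ∷ L ⟫)
          ≈⟨ solve 3 (λ a b c → a :+ (b :+ c) := b :+ (c :+ a)) refl _ _ _ ⟩
        q (3 ℕ.+ k) + (⟪ false ∷ true ∷ L ⟫ + ⟪ false ∷ false ∷ L ⟫)
          ≈⟨ +-congˡ (⟪⟫-* (false ∷ []) L) ⟨
        q (3 ℕ.+ k) + ⟪ false ∷ [] ⟫ * ⟪ L ⟫
          ≈⟨ +-congˡ (*-congʳ (row≈column 1)) ⟨
        q (3 ℕ.+ k) + h * q (1 ℕ.+ k) ∎
        where
        L : Word
        L = replicate k true

      -- The term with `k = 1` is isolated because only it has to cancel against the derivative of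
      -- `1 - u t + u² t² / 2`. The remaining terms pass through this factor by `conv-tri₃`.
      euler-q : ∀ n → euler q n ≈ u * shift q n + conv P≥₃ q n
      euler-q n = trans (newton sortedˡ n) (split n)
        where
        split : ∀ n → conv P q n ≈ u * shift q n + conv P≥₃ q n
        split 0 = trans (*-congʳ P₀≈0) (sym (trans (+-congʳ (zeroʳ _)) (+-identityˡ _)))
        split 1 = trans (+-congʳ (*-congʳ P₀≈0)) (solve 3 (λ u a b → con 0 :* a :+ u :* b
          := u :* b :+ (con 0 :* a :+ con 0 :* b)) refl u _ _)
        split (suc (suc n)) = trans (+-congʳ (*-congʳ P₀≈0)) (solve 4 (λ u a b c → con 0 :* a :+ (u :* b :+ c)
          := u :* b :+ (con 0 :* a :+ (con 0 :* b :+ c))) refl u _ _ _)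

      conv-tri₃ : ∀ n → conv P≥₃ tri₃ n + u * shift (conv P≥₃ q) n ≈
                        conv P≥₃ q n + h * shift (shift (conv P≥₃ q)) n
      conv-tri₃ n = begin
        conv P≥₃ tri₃ n + u * shift (conv P≥₃ q) n
          ≈⟨ +-congˡ (*-congˡ (conv-shiftʳ P≥₃ q n)) ⟨
        conv P≥₃ tri₃ n + u * conv P≥₃ (shift q) n
          ≈⟨ +-congˡ (conv-*ʳ P≥₃ u _ n) ⟨
        conv P≥₃ tri₃ n + conv P≥₃ (λ k → u * shift q k) n
          ≈⟨ conv-+ʳ P≥₃ _ _ n ⟨
        conv P≥₃ (λ k → tri₃ k + u * shift q k) n
          ≈⟨ conv-congʳ P≥₃ tri₃-relation n ⟩
        conv P≥₃ (λ k → q k + h * shift (shift q) k) n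
          ≈⟨ conv-+ʳ P≥₃ _ _ n ⟩
        conv P≥₃ q n + conv P≥₃ (λ k → h * shift (shift q) k) n
          ≈⟨ +-congˡ (conv-*ʳ P≥₃ h _ n) ⟩
        conv P≥₃ q n + h * conv P≥₃ (shift (shift q)) n
          ≈⟨ +-congˡ (*-congˡ (trans (conv-shiftʳ P≥₃ (shift q) n) (shift-cong (conv-shiftʳ P≥₃ q) n))) ⟩
        conv P≥₃ q n + h * shift (shift (conv P≥₃ q)) n ∎

      shift-+ : ∀ f g n → shift (λ k → f k + g k) n ≈ shift f n + shift g n
      shift-+ f g zero    = sym (+-identityˡ 0#)
      shift-+ f g (suc n) = refl

      shift-* : ∀ a f n → shift (λ k → a * f k) n ≈ a * shift f n
      shift-* a f zero    = sym (zeroʳ a)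
      shift-* a f (suc n) = refl

    -- With Q = Σ qₙ tⁿ the series Σ tri₃ₙ tⁿ is (1 - u t + u² t²/2) Q. In its Euler derivative the
    -- terms from u t cancel up to u³ t³/2 · Q.
    newton-tri₃ : ∀ n → euler tri₃ n ≈ (u * h) * shift (shift (shift q)) n + conv P≥₃ tri₃ n
    newton-tri₃ n = cancelʳ (u * q¹ + u * (u * q²) + u * v¹) (begin
      b + (u * q¹ + u * (u * q²) + u * v¹)
        ≈⟨ solve 5 (λ b u q₁ q₂ v₁ → b :+ (u :* q₁ :+ u :* (u :* q₂) :+ u :* v₁)
              := (b :+ u :* ((u :* q₂ :+ v₁) :+ q₁))) refl b u q¹ q² v¹ ⟩
      b + u * ((u * q² + v¹) + q¹)
        ≈⟨ euler-relation ⟩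
      (u * q¹ + v⁰) + h * ((u * q³ + v²) + (q² + q²))
        ≈⟨ solve 7 (λ u h q₁ q₂ q₃ v₀ v₂ → (u :* q₁ :+ v₀) :+ h :* ((u :* q₃ :+ v₂) :+ (q₂ :+ q₂))
             := u :* h :* q₃ :+ (v₀ :+ h :* v₂) :+ (u :* q₁ :+ (h :+ h) :* q₂)) refl u h q¹ q² q³ v⁰ v² ⟩
      u * h * q³ + (v⁰ + h * v²) + (u * q¹ + (h + h) * q²)
        ≈⟨ +-cong (+-congˡ (conv-tri₃ n)) (+-congˡ (*-congʳ straight₂)) ⟨
      u * h * q³ + (w + u * v¹) + (u * q¹ + u * u * q²)
        ≈⟨ solve 6 (λ a w u v₁ q₁ q₂ → a :+ (w :+ u :* v₁) :+ (u :* q₁ :+ u :* u :* q₂)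
             := a :+ w :+ (u :* q₁ :+ u :* (u :* q₂) :+ u :* v₁)) refl _ w u v¹ q¹ q² ⟩
      (u * h * q³ + w) + (u * q¹ + u * (u * q²) + u * v¹) ∎)
      where
      open SRMult semiring using (×-comm-*; ×-congʳ)
      open CMMult +-commutativeMonoid using (×-distrib-+)
      b w q¹ q² q³ v⁰ v¹ v² : Carrier
      b  = euler tri₃ n
      w  = conv P≥₃ tri₃ n
      q¹ = shift q n
      q² = shift (shift q) n
      q³ = shift (shift (shift q)) n
      v⁰ = conv P≥₃ q n
      v¹ = shift (conv P≥₃ q) n
      v² = shift (shift (conv P≥₃ q)) n
      shift-euler-q : ∀ n → shift (euler q) n ≈ u * shift (shift q) n + shift (conv P≥₃ q) n
      shift-euler-q n = trans (shift-cong euler-q n) (trans (shift-+ _ _ n) (+-congʳ (shift-* u (shift q) n)))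
      euler-shift² : ∀ n → euler (shift (shift q)) n ≈ shift (shift (euler q)) n + (shift (shift q) n + shift (shift q) n)
      euler-shift² n = trans (euler-shift (shift q) n) (trans (+-congʳ (trans (shift-cong (euler-shift q) n) (shift-+ _ _ n)))
        (+-assoc _ _ _))
      -- The Euler derivation applied to `tri₃-relation`. On the left, everything besides `b` is the
      -- derivative of `u * shift q`; expanded, it is the summand that `newton-tri₃` adds on both
      -- sides and cancels.
      euler-relation : b + u * ((u * q² + v¹) + q¹) ≈ (u * q¹ + v⁰) + h * ((u * q³ + v²) + (q² + q²))
      euler-relation = begin
        b + u * ((u * q² + v¹) + q¹)
          ≈⟨ +-congˡ (*-congˡ (trans (euler-shift q n) (+-congʳ (shift-euler-q n)))) ⟨
        b + u * euler (shift q) n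
          ≈⟨ trans (×-distrib-+ _ _ n) (+-congˡ (sym (×-comm-* n u _))) ⟨
        n ×ₙ (tri₃ n + u * shift q n)
          ≈⟨ ×-congʳ n (tri₃-relation n) ⟩
        n ×ₙ (q n + h * shift (shift q) n)
          ≈⟨ trans (×-distrib-+ _ _ n) (+-congˡ (sym (×-comm-* n h _))) ⟩
        euler q n + h * euler (shift (shift q)) n
          ≈⟨ +-cong (euler-q n) (*-congˡ (trans (euler-shift² n) (+-congʳ
               (trans (shift-cong shift-euler-q n) (trans (shift-+ _ _ n) (+-congʳ (shift-* u _ n))))))) ⟩
        (u * q¹ + v⁰) + h * ((u * q³ + v²) + (q² + q²)) ∎

open ≡ using (refl; sym; trans; cong; cong₂; subst; _≢_; module ≡-Reasoning)

-- Polynomials with rational coefficients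

ℚ-semiring : CommutativeSemiring 0ℓ 0ℓ
ℚ-semiring = CommutativeRing.commutativeSemiring ℚₚ.+-*-commutativeRing

module ℚ∑ = Sums ℚ-semiring

open SRMult (CommutativeSemiring.semiring ℚ-semiring) using () renaming (_×_ to _×ℚ_) public

toℚ-suc : ∀ n → toℚ (suc n) ≡ 1ℚ ℚ.+ toℚ n
toℚ-suc n = ℚₚ.toℚᵘ-injective (ℚᵘₚ.≃-trans (ℚₚ.toℚᵘ-fromℚᵘ (ℚᵘ.mkℚᵘ (+ suc n) 0))
  (ℚᵘₚ.≃-trans (ℚᵘ.*≡* (cong (λ z → (+ 1 ℤ.+ z) ℤ.* + 1) (sym (ℤₚ.*-identityʳ (+ n)))))
  (ℚᵘₚ.≃-sym (ℚᵘₚ.≃-trans (ℚₚ.toℚᵘ-homo-+ 1ℚ (toℚ n))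
    (ℚᵘₚ.+-congʳ (ℚᵘ.mkℚᵘ (+ 1) 0) (ℚₚ.toℚᵘ-fromℚᵘ (ℚᵘ.mkℚᵘ (+ n) 0)))))))

toℚ≡×1 : ∀ n → toℚ n ≡ n ×ℚ 1ℚ
toℚ≡×1 zero    = refl
toℚ≡×1 (suc n) = trans (toℚ-suc n) (cong (1ℚ ℚ.+_) (toℚ≡×1 n))

×ℚ-toℚ : ∀ n y → n ×ℚ y ≡ toℚ n ℚ.* y
×ℚ-toℚ n y = begin
  n ×ℚ y              ≡⟨ cong (n ×ℚ_) (ℚₚ.*-identityˡ y) ⟨
  n ×ℚ (1ℚ ℚ.* y)     ≡⟨ SRMult.×-assoc-* (CommutativeSemiring.semiring ℚ-semiring) n 1ℚ y ⟨
  (n ×ℚ 1ℚ) ℚ.* y     ≡⟨ cong (ℚ._* y) (toℚ≡×1 n) ⟨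
  toℚ n ℚ.* y         ∎
  where open ≡-Reasoning

toℚ-length-filter : ∀ {A : Set} (p : A → Bool) xs → toℚ (length (filterᵇ p xs)) ≡ ℚ∑.∑ xs (λ x → ℚ∑.[ p x ]· 1ℚ)
toℚ-length-filter p []       = refl
toℚ-length-filter p (x ∷ xs) with p x
... | true  = trans (toℚ-suc (length (filterᵇ p xs))) (cong (1ℚ ℚ.+_) (toℚ-length-filter p xs))
... | false = trans (toℚ-length-filter p xs) (sym (ℚₚ.+-identityˡ _))

unitFraction : ℕ → ℚ
unitFraction n = + 1 ℚ./ suc n

unitFraction-≥0 : ∀ n → 0ℚ ℚ.≤ unitFraction n
unitFraction-≥0 n = ℚₚ.nonNegative⁻¹ (unitFraction n) {{ℚₚ.normalize-nonNeg 1 (suc n)}}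

unitFraction-* : ∀ n → unitFraction n ℚ.* toℚ (suc n) ≡ 1ℚ
unitFraction-* n = ℚₚ.toℚᵘ-injective (ℚᵘₚ.≃-trans (ℚₚ.toℚᵘ-homo-* (unitFraction n) (toℚ (suc n)))
  (ℚᵘₚ.≃-trans (ℚᵘₚ.*-cong (ℚₚ.toℚᵘ-fromℚᵘ (ℚᵘ.mkℚᵘ (+ 1) n)) (ℚₚ.toℚᵘ-fromℚᵘ (ℚᵘ.mkℚᵘ (+ suc n) 0)))
  (ℚᵘ.*≡* (ℤₚ.*-assoc (+ 1) (+ suc n) (+ 1)))))

unitFraction-×ℚ : ∀ n y → unitFraction n ℚ.* (suc n ×ℚ y) ≡ y
unitFraction-×ℚ n y = trans (cong (unitFraction n ℚ.*_) (×ℚ-toℚ (suc n) y))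
  (trans (sym (ℚₚ.*-assoc (unitFraction n) (toℚ (suc n)) y))
  (trans (cong (ℚ._* y) (unitFraction-* n)) (ℚₚ.*-identityˡ y)))

×ℚ-torsionFree : ∀ n {y z} → suc n ×ℚ y ≡ suc n ×ℚ z → y ≡ z
×ℚ-torsionFree n {y} {z} e = trans (sym (unitFraction-×ℚ n y))
  (trans (cong (unitFraction n ℚ.*_) e) (unitFraction-×ℚ n z))

module Polynomials (m : ℕ) where
  open Sums ℚ-semiring
  open SemiringSolver ℚ-semiring using (solve; _:+_; _:*_; _:=_)

  Exponent : Set
  Exponent = Vec ℕ m

  infixl 6 _⊕_
  _⊕_ : Exponent → Exponent → Exponent
  _⊕_ = Vec.zipWith ℕ._+_

  Poly : Set
  Poly = List (ℚ × Exponent)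

  -- The linear extension of `f` from monomials to polynomials.
  eval : Poly → (Exponent → ℚ) → ℚ
  eval p f = ∑ p (λ (c , e) → c ℚ.* f e)

  -- Polynomials are identified when all linear functionals agree on them.
  infix 4 _≈ₚ_
  record _≈ₚ_ (p r : Poly) : Set where
    constructor pointwise
    field at : ∀ f → eval p f ≡ eval r f
  open _≈ₚ_ public

  0ₚ 1ₚ : Poly
  0ₚ = []
  1ₚ = (1ℚ , Vec.replicate m 0) ∷ []

  infixl 6 _+ₚ_
  _+ₚ_ : Poly → Poly → Poly
  _+ₚ_ = _++_

  infixl 7 _*ₚ_
  _*ₚ_ : Poly → Poly → Poly
  p *ₚ r = concatMap (λ (c , e) → map (λ (d , e′) → (c ℚ.* d , e ⊕ e′)) r) p

  eval-cong : ∀ p {f g} → (∀ e → f e ≡ g e) → eval p f ≡ eval p g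
  eval-cong p h = ∑-cong p (λ (c , e) → cong (c ℚ.*_) (h e))

  eval-+ : ∀ p r f → eval (p +ₚ r) f ≡ eval p f ℚ.+ eval r f
  eval-+ p r f = ∑-++ p r _

  -- Products become iterated evaluations. The semiring laws then follow from the laws of adding
  -- exponents and from exchanging finite sums.
  eval-* : ∀ p r f → eval (p *ₚ r) f ≡ eval p (λ e → eval r (λ e′ → f (e ⊕ e′)))
  eval-* p r f = trans (∑-concatMap _ p _) (∑-cong p (λ (c , e) →
    trans (∑-map _ r _) (trans (∑-cong r (λ (d , e′) → ℚₚ.*-assoc c d (f (e ⊕ e′))))
            (sym (∑-*ˡ r _ c)))))

  eval-1 : ∀ f → eval 1ₚ f ≡ f (Vec.replicate m 0)
  eval-1 f = trans (ℚₚ.+-identityʳ _) (ℚₚ.*-identityˡ _)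

  eval-*f : ∀ p f c → c ℚ.* eval p f ≡ eval p (λ e → c ℚ.* f e)
  eval-*f p f c = trans (∑-*ˡ p _ c) (∑-cong p (λ (d , e) →
    solve 3 (λ c d f → c :* (d :* f) := d :* (c :* f)) refl c d (f e)))

  eval-swap : ∀ p r (f : Exponent → Exponent → ℚ) →
              eval p (λ e → eval r (f e)) ≡ eval r (λ e′ → eval p (λ e → f e e′))
  eval-swap p r f = trans (∑-cong p (λ (c , e) → eval-*f r (f e) c))
    (trans (∑-swap p r _) (∑-cong r (λ (d , e′) → trans
      (∑-cong p (λ (c , e) → solve 3 (λ d c f → d :* (c :* f) := c :* (d :* f)) refl d c (f e e′)))
      (sym (eval-*f p (λ e → f e e′) d)))))

  *ₚ-cong : ∀ {p p′ r r′} → p ≈ₚ p′ → r ≈ₚ r′ → p *ₚ r ≈ₚ p′ *ₚ r′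
  *ₚ-cong {p} {p′} {r} {r′} h k = pointwise λ f → begin
    eval (p *ₚ r) f                              ≡⟨ eval-* p r f ⟩
    eval p (λ e → eval r (λ e′ → f (e ⊕ e′)))    ≡⟨ eval-cong p (λ e → at k _) ⟩
    eval p (λ e → eval r′ (λ e′ → f (e ⊕ e′)))   ≡⟨ at h _ ⟩
    eval p′ (λ e → eval r′ (λ e′ → f (e ⊕ e′)))  ≡⟨ eval-* p′ r′ f ⟨
    eval (p′ *ₚ r′) f                            ∎
    where open ≡-Reasoning

  *ₚ-comm : ∀ p r → p *ₚ r ≈ₚ r *ₚ p
  *ₚ-comm p r = pointwise λ f → begin
    eval (p *ₚ r) f                              ≡⟨ eval-* p r f ⟩
    eval p (λ e → eval r (λ e′ → f (e ⊕ e′)))    ≡⟨ eval-swap p r _ ⟩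
    eval r (λ e′ → eval p (λ e → f (e ⊕ e′)))
      ≡⟨ eval-cong r (λ e′ → eval-cong p (λ e → cong f (Vecₚ.zipWith-comm ℕₚ.+-comm e e′))) ⟩
    eval r (λ e′ → eval p (λ e → f (e′ ⊕ e)))    ≡⟨ eval-* r p f ⟨
    eval (r *ₚ p) f                              ∎
    where open ≡-Reasoning

  *ₚ-assoc : ∀ p r s → (p *ₚ r) *ₚ s ≈ₚ p *ₚ (r *ₚ s)
  *ₚ-assoc p r s = pointwise λ f → begin
    eval ((p *ₚ r) *ₚ s) f
      ≡⟨ trans (eval-* (p *ₚ r) s f) (eval-* p r _) ⟩
    eval p (λ e → eval r (λ e′ → eval s (λ e″ → f ((e ⊕ e′) ⊕ e″))))
      ≡⟨ eval-cong p (λ e → eval-cong r (λ e′ → eval-cong s (λ e″ → cong f (Vecₚ.zipWith-assoc ℕₚ.+-assoc e e′ e″)))) ⟩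
    eval p (λ e → eval r (λ e′ → eval s (λ e″ → f (e ⊕ (e′ ⊕ e″)))))
      ≡⟨ trans (eval-* p (r *ₚ s) f) (eval-cong p (λ e → eval-* r s _)) ⟨
    eval (p *ₚ (r *ₚ s)) f ∎
    where open ≡-Reasoning

  *ₚ-identityˡ : ∀ p → 1ₚ *ₚ p ≈ₚ p
  *ₚ-identityˡ p = pointwise λ f → trans (eval-* 1ₚ p f) (trans (eval-1 (λ e → eval p (λ e′ → f (e ⊕ e′))))
    (eval-cong p (λ e → cong f (Vecₚ.zipWith-identityˡ {f = ℕ._+_} {0} ℕₚ.+-identityˡ e))))

  *ₚ-distribʳ : ∀ s p r → (p +ₚ r) *ₚ s ≈ₚ p *ₚ s +ₚ r *ₚ s
  *ₚ-distribʳ s p r = pointwise λ f → begin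
    eval ((p +ₚ r) *ₚ s) f                ≡⟨ trans (eval-* (p +ₚ r) s f) (eval-+ p r _) ⟩
    eval p (λ e → eval s (λ e′ → f (e ⊕ e′))) ℚ.+ eval r (λ e → eval s (λ e′ → f (e ⊕ e′)))
                                          ≡⟨ cong₂ ℚ._+_ (eval-* p s f) (eval-* r s f) ⟨
    eval (p *ₚ s) f ℚ.+ eval (r *ₚ s) f   ≡⟨ eval-+ (p *ₚ s) (r *ₚ s) f ⟨
    eval (p *ₚ s +ₚ r *ₚ s) f             ∎
    where open ≡-Reasoning

  +ₚ-cong : ∀ {p p′ r r′} → p ≈ₚ p′ → r ≈ₚ r′ → p +ₚ r ≈ₚ p′ +ₚ r′
  +ₚ-cong {p} {p′} {r} {r′} h k = pointwise λ f → trans (eval-+ p r f)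
    (trans (cong₂ ℚ._+_ (at h f) (at k f)) (sym (eval-+ p′ r′ f)))

  +ₚ-comm : ∀ p r → p +ₚ r ≈ₚ r +ₚ p
  +ₚ-comm p r = pointwise λ f → trans (eval-+ p r f)
    (trans (ℚₚ.+-comm (eval p f) (eval r f)) (sym (eval-+ r p f)))

  +ₚ-assoc : ∀ p r s → (p +ₚ r) +ₚ s ≈ₚ p +ₚ (r +ₚ s)
  +ₚ-assoc p r s = pointwise λ f → begin
    eval ((p +ₚ r) +ₚ s) f                       ≡⟨ trans (eval-+ (p +ₚ r) s f) (cong (ℚ._+ eval s f) (eval-+ p r f)) ⟩
    (eval p f ℚ.+ eval r f) ℚ.+ eval s f         ≡⟨ ℚₚ.+-assoc (eval p f) (eval r f) (eval s f) ⟩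
    eval p f ℚ.+ (eval r f ℚ.+ eval s f)         ≡⟨ trans (eval-+ p (r +ₚ s) f) (cong (eval p f ℚ.+_) (eval-+ r s f)) ⟨
    eval (p +ₚ (r +ₚ s)) f                       ∎
    where open ≡-Reasoning

  poly-semiring : CommutativeSemiring 0ℓ 0ℓ
  poly-semiring = record
    { Carrier = Poly
    ; _≈_ = _≈ₚ_
    ; _+_ = _+ₚ_
    ; _*_ = _*ₚ_
    ; 0# = 0ₚ
    ; 1# = 1ₚ
    ; isCommutativeSemiring = record
      { isSemiring = record
        { isSemiringWithoutAnnihilatingZero = record
          { +-isCommutativeMonoid = record
            { isMonoid = record
              { isSemigroup = record
                { isMagma = record
                  { isEquivalence = ≈ₚ-isEquivalence
                  ; ∙-cong = +ₚ-cong
                  }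
                ; assoc = +ₚ-assoc
                }
              ; identity = (λ p → ≈ₚ-refl) , (λ p → ≈ₚ-trans (+ₚ-comm p 0ₚ) ≈ₚ-refl)
              }
            ; comm = +ₚ-comm
            }
          ; *-cong = *ₚ-cong
          ; *-assoc = *ₚ-assoc
          ; *-identity = *ₚ-identityˡ , λ p → ≈ₚ-trans (*ₚ-comm p 1ₚ) (*ₚ-identityˡ p)
          ; distrib = (λ s p r → ≈ₚ-trans (*ₚ-comm s (p +ₚ r)) (≈ₚ-trans (*ₚ-distribʳ s p r)
                        (+ₚ-cong (*ₚ-comm p s) (*ₚ-comm r s)))) , *ₚ-distribʳ
          }
        ; zero = (λ p → ≈ₚ-refl) , (λ p → *ₚ-comm p 0ₚ)
        }
      ; *-comm = *ₚ-comm
      }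
    }
    where
    ≈ₚ-refl : ∀ {p} → p ≈ₚ p
    ≈ₚ-refl = pointwise λ f → refl
    ≈ₚ-trans : ∀ {p r s} → p ≈ₚ r → r ≈ₚ s → p ≈ₚ s
    ≈ₚ-trans h k = pointwise λ f → trans (at h f) (at k f)
    ≈ₚ-isEquivalence : IsEquivalence _≈ₚ_
    ≈ₚ-isEquivalence = record
      { refl = ≈ₚ-refl ; sym = λ h → pointwise λ f → sym (at h f) ; trans = ≈ₚ-trans }

  open SRMult (CommutativeSemiring.semiring poly-semiring) using () renaming (_×_ to _×ₚ_)

  eval-× : ∀ n p f → eval (n ×ₚ p) f ≡ n ×ℚ eval p f
  eval-× zero    p f = refl
  eval-× (suc n) p f = trans (eval-+ p (n ×ₚ p) f) (cong (eval p f ℚ.+_) (eval-× n p f))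

  +ₚ-cancelʳ : ∀ s {p r} → p +ₚ s ≈ₚ r +ₚ s → p ≈ₚ r
  +ₚ-cancelʳ s {p} {r} h = pointwise λ f → ∙-cancelʳ ℚₚ.+-0-group (eval s f) (eval p f) (eval r f)
    (trans (sym (eval-+ p s f)) (trans (at h f) (eval-+ r s f)))

  ×ₚ-torsionFree : ∀ n {p r} → suc n ×ₚ p ≈ₚ suc n ×ₚ r → p ≈ₚ r
  ×ₚ-torsionFree n {p} {r} h = pointwise λ f → ×ℚ-torsionFree n
    (trans (sym (eval-× (suc n) p f)) (trans (at h f) (eval-× (suc n) r f)))

  eval-∑ : ∀ {A : Set} (xs : List A) g f → eval (Sums.∑ poly-semiring xs g) f ≡ ∑ xs (λ x → eval (g x) f)
  eval-∑ []       g f = refl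
  eval-∑ (x ∷ xs) g f = trans (eval-+ (g x) _ f) (cong (eval (g x) f ℚ.+_) (eval-∑ xs g f))

  infixr 7 _•_
  _•_ : ℚ → Poly → Poly
  c • p = map (λ (d , e) → (c ℚ.* d , e)) p

  eval-• : ∀ c p f → eval (c • p) f ≡ c ℚ.* eval p f
  eval-• c p f = trans (∑-map _ p _) (trans
    (∑-cong p (λ (d , e) → ℚₚ.*-assoc c d (f e))) (sym (∑-*ˡ p _ c)))

  monomial : Exponent → Poly
  monomial e = (1ℚ , e) ∷ []

  eval-monomial-* : ∀ e p f → eval (monomial e *ₚ p) f ≡ eval p (λ e′ → f (e ⊕ e′))
  eval-monomial-* e p f = trans (eval-* (monomial e) p f) (trans (ℚₚ.+-identityʳ _) (ℚₚ.*-identityˡ _))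

-- Marked shifted tableaux of a ribbon

T⇒true : ∀ {b} → T b → b ≡ true
T⇒true {true} _ = refl

¬T⇒false : ∀ {b} → ¬ T b → b ≡ false
¬T⇒false {false} _ = refl
¬T⇒false {true}  n = contradiction _ n

true⇒T : ∀ {b} → b ≡ true → T b
true⇒T refl = _

<ᵇ-true : ∀ {i j} → i ℕ.< j → (i ℕ.<ᵇ j) ≡ true
<ᵇ-true = T⇒true ∘ ℕₚ.<⇒<ᵇ

<ᵇ-false : ∀ {i j} → j ℕ.≤ i → (i ℕ.<ᵇ j) ≡ false
<ᵇ-false {i} {j} j≤i = ¬T⇒false (ℕₚ.≤⇒≯ j≤i ∘ ℕₚ.<ᵇ⇒< i j)

≤ᵇ-true : ∀ {i j} → i ℕ.≤ j → (i ℕ.≤ᵇ j) ≡ true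
≤ᵇ-true = T⇒true ∘ ℕₚ.≤⇒≤ᵇ

≤ᵇ-false : ∀ {i j} → j ℕ.< i → (i ℕ.≤ᵇ j) ≡ false
≤ᵇ-false {i} {j} j<i = ¬T⇒false (ℕₚ.<⇒≱ j<i ∘ ℕₚ.≤ᵇ⇒≤ i j)

==ℤ-refl : ∀ i → (i ==ℤ i) ≡ true
==ℤ-refl i = dec-true (i ℤ.≟ i) refl

==ℤ-≢ : ∀ {i j} → i ≢ j → (i ==ℤ j) ≡ false
==ℤ-≢ {i} {j} = dec-false (i ℤ.≟ j)

<ℤ-true : ∀ {i j} → i ℤ.< j → (i <ℤ j) ≡ true
<ℤ-true {i} {j} i<j = T⇒true (ℤₚ.≤⇒≤ᵇ (subst (ℤ._≤ j) (ℤₚ.+-comm (+ 1) i) (ℤₚ.i<j⇒suc[i]≤j i<j)))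

<ℤ-false : ∀ {i j} → j ℤ.< i → (i <ℤ j) ≡ false
<ℤ-false {i} {j} j<i = ¬T⇒false λ t → ℤₚ.<-asym j<i
  (ℤₚ.suc[i]≤j⇒i<j (subst (ℤ._≤ j) (ℤₚ.+-comm i (+ 1)) (ℤₚ.≤ᵇ⇒≤ t)))

==F-refl : ∀ {m} (v : Fin m) → (v ==F v) ≡ true
==F-refl v = dec-true (v Fin.≟ v) refl

==F-≢ : ∀ {m} {v u : Fin m} → v ≢ u → (v ==F u) ≡ false
==F-≢ {v = v} {u} = dec-false (v Fin.≟ u)

-- Exactly the values below this bound fit to the left of the letter. A marked `v` excludes every
-- further `v` on its left, as `v′` is smaller than `v` and occurs once per row; an unmarked `v`
-- admits both letters of value `v` there.
bound : ∀ {m} → Letter m → ℕ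
bound (v , mk) = if mk then toℕ v else suc (toℕ v)

-- whether a letter with value u may stand to the left of the letter l (true) or below it (false)
canFollow : ∀ {m} → Bool → Letter m → Fin m → Bool
canFollow true  l u = toℕ u ℕ.<ᵇ bound l
canFollow false l u = not (canFollow true l u)

module _ {m : ℕ} where

  canFollow-> : ∀ {v u : Fin m} mk → u Fin.< v → canFollow true (v , mk) u ≡ true
  canFollow-> true  u<v = <ᵇ-true u<v
  canFollow-> false u<v = <ᵇ-true (ℕₚ.m<n⇒m<1+n u<v)

  canFollow-< : ∀ {v u : Fin m} mk → v Fin.< u → canFollow true (v , mk) u ≡ false
  canFollow-< true  v<u = <ᵇ-false (ℕₚ.<⇒≤ v<u)
  canFollow-< false v<u = <ᵇ-false v<u

  canFollow-≡ : ∀ (v : Fin m) mk → canFollow true (v , mk) v ≡ not mk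
  canFollow-≡ v true  = <ᵇ-false (ℕₚ.≤-refl {toℕ v})
  canFollow-≡ v false = <ᵇ-true (ℕₚ.n<1+n (toℕ v))

  key-< : ∀ {v u : Fin m} a b → v Fin.< u → key (v , a) ℕ.< key (u , b)
  key-< {v} {u} a b v<u = begin-strict
    2 ℕ.* toℕ v ℕ.+ (if a then 0 else 1)   ≤⟨ ℕₚ.+-monoʳ-≤ (2 ℕ.* toℕ v) (bit a) ⟩
    2 ℕ.* toℕ v ℕ.+ 1                      <⟨ ℕₚ.+-monoʳ-< (2 ℕ.* toℕ v) (ℕₚ.n<1+n 1) ⟩
    2 ℕ.* toℕ v ℕ.+ 2                      ≡⟨ trans (ℕₚ.+-comm _ 2) (sym (ℕₚ.*-suc 2 (toℕ v))) ⟩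
    2 ℕ.* suc (toℕ v)                      ≤⟨ ℕₚ.*-monoʳ-≤ 2 v<u ⟩
    2 ℕ.* toℕ u                            ≤⟨ ℕₚ.m≤m+n _ _ ⟩
    2 ℕ.* toℕ u ℕ.+ (if b then 0 else 1)   ∎
    where
    open ℕₚ.≤-Reasoning
    bit : ∀ a → (if a then 0 else 1) ℕ.≤ 1
    bit true  = ℕ.z≤n
    bit false = ℕₚ.≤-refl

  -- The left side is what `okPair`, taken in both orders, reduces to for two boxes of one row with
  -- `(v , a)` on the right. In `column-rule` the letter `(v , a)` is the upper one.
  row-rule : ∀ (v : Fin m) a u b →
    not (a ∧ b ∧ v ==F u) ∧ ((key (u , b) ℕ.≤ᵇ key (v , a)) ∧ not (b ∧ a ∧ u ==F v)) ≡ canFollow true (v , a) u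
  row-rule v a u b with Finₚ.<-cmp v u
  ... | tri< v<u v≢u _ rewrite canFollow-< a v<u | ≤ᵇ-false (key-< a b v<u) = Boolₚ.∧-zeroʳ _
  ... | tri> _ v≢u u<v rewrite canFollow-> a u<v | ≤ᵇ-true (ℕₚ.<⇒≤ (key-< b a u<v))
                             | ==F-≢ v≢u | ==F-≢ (v≢u ∘ sym) = marks a b
    where
    marks : ∀ a b → not (a ∧ b ∧ false) ∧ (true ∧ not (b ∧ a ∧ false)) ≡ true
    marks true  true  = refl
    marks true  false = refl
    marks false true  = refl
    marks false false = refl
  ... | tri≈ _ refl _ rewrite canFollow-≡ v a | ==F-refl v = marks a b
    where
    marks : ∀ a b → not (a ∧ b ∧ true) ∧ ((key (v , b) ℕ.≤ᵇ key (v , a)) ∧ not (b ∧ a ∧ true)) ≡ not a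
    marks true  true  = refl
    marks true  false rewrite ≤ᵇ-false (ℕₚ.+-monoʳ-< (2 ℕ.* toℕ v) (ℕₚ.n<1+n 0)) = refl
    marks false true  rewrite ≤ᵇ-true (ℕₚ.+-monoʳ-≤ (2 ℕ.* toℕ v) (ℕ.z≤n {1})) = refl
    marks false false rewrite ≤ᵇ-true (ℕₚ.≤-refl {key (v , false)}) = refl

  column-rule : ∀ (v : Fin m) a u b →
    ((key (v , a) ℕ.≤ᵇ key (u , b)) ∧ not (not a ∧ not b ∧ v ==F u) ∧ true) ∧ (not (not b ∧ not a ∧ u ==F v) ∧ true)
      ≡ canFollow false (v , a) u
  column-rule v a u b with Finₚ.<-cmp v u
  ... | tri> _ v≢u u<v rewrite canFollow-> a u<v | ≤ᵇ-false (key-< b a u<v) = refl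
  ... | tri< v<u v≢u _ rewrite canFollow-< a v<u | ≤ᵇ-true (ℕₚ.<⇒≤ (key-< a b v<u))
                             | ==F-≢ v≢u | ==F-≢ (v≢u ∘ sym) = marks a b
    where
    marks : ∀ a b → (true ∧ not (not a ∧ not b ∧ false) ∧ true) ∧ (not (not b ∧ not a ∧ false) ∧ true) ≡ true
    marks true  true  = refl
    marks true  false = refl
    marks false true  = refl
    marks false false = refl
  ... | tri≈ _ refl _ rewrite canFollow-≡ v a | ==F-refl v = marks a b
    where
    marks : ∀ a b → ((key (v , a) ℕ.≤ᵇ key (v , b)) ∧ not (not a ∧ not b ∧ true) ∧ true)
                    ∧ (not (not b ∧ not a ∧ true) ∧ true) ≡ not (not a)
    marks true  true  rewrite ≤ᵇ-true (ℕₚ.≤-refl {key (v , true)}) = refl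
    marks true  false rewrite ≤ᵇ-true (ℕₚ.+-monoʳ-≤ (2 ℕ.* toℕ v) (ℕ.z≤n {1})) = refl
    marks false true  rewrite ≤ᵇ-false (ℕₚ.+-monoʳ-< (2 ℕ.* toℕ v) (ℕₚ.n<1+n 0)) = refl
    marks false false = Boolₚ.∧-zeroʳ _

  -- This reduces the conditions on all pairs within a row or a column to those on neighbouring
  -- boxes.
  canFollow-trans : ∀ s {v a u b} (w : Fin m) →
    canFollow s (v , a) u ≡ true → canFollow s (u , b) w ≡ true → canFollow s (v , a) w ≡ true
  canFollow-trans true {v} {a} {u} {b} w p q = <ᵇ-true {j = bound (v , a)}
    (ℕₚ.≤-<-trans (below b (ℕₚ.<ᵇ⇒< (toℕ w) (bound (u , b)) (true⇒T q)))
                  (ℕₚ.<ᵇ⇒< (toℕ u) (bound (v , a)) (true⇒T p)))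
    where
    below : ∀ b → toℕ w ℕ.< bound (u , b) → toℕ w ℕ.≤ toℕ u
    below true  = ℕₚ.<⇒≤
    below false = ℕ.s≤s⁻¹
  canFollow-trans false {v} {a} {u} {b} w p q = cong not (<ᵇ-false {j = bound (v , a)}
    (ℕₚ.≤-trans (≥-from (toℕ u) (bound (v , a)) p)
                (ℕₚ.≤-trans (above b) (≥-from (toℕ w) (bound (u , b)) q))))
    where
    ≥-from : ∀ i j → not (i ℕ.<ᵇ j) ≡ true → j ℕ.≤ i
    ≥-from i j e = ℕₚ.≮⇒≥ λ i<j → contradiction (trans (sym e) (cong not (<ᵇ-true i<j))) λ ()
    above : ∀ b → toℕ u ℕ.≤ bound (u , b)
    above true  = ℕₚ.≤-refl
    above false = ℕₚ.n≤1+n _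

-- The boxes of a ribbon as a lattice walk

Box : Set
Box = ℤ × ℤ

step : Bool → Box → Box
step true  (i , j) = (i , j ℤ.- + 1)
step false (i , j) = (i ℤ.+ + 1 , j)

walk walkTail : Box → Word → List Box
walk p w = p ∷ walkTail p w
walkTail p []      = []
walkTail p (s ∷ w) = walk (step s p) w

pred-< : ∀ j → j ℤ.- + 1 ℤ.< j
pred-< j = ℤₚ.suc[i]≤j⇒i<j (ℤₚ.≤-reflexive (lem j))
  where
  lem : ∀ j → + 1 ℤ.+ (j ℤ.- + 1) ≡ j
  lem = solve-∀

<-succ : ∀ i → i ℤ.< i ℤ.+ + 1
<-succ i = ℤₚ.suc[i]≤j⇒i<j (ℤₚ.≤-reflexive (ℤₚ.+-comm (+ 1) i))

-- A later box of the walk lies either on the same straight segment, which is `Ahead`, or strictly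
-- below and to the left, which is `Far`. In the second case no tableau condition relates the two
-- letters.
Ahead : Bool → Box → Box → Set
Ahead true  (i , j) (i′ , j′) = i′ ≡ i × j′ ℤ.< j
Ahead false (i , j) (i′ , j′) = i ℤ.< i′ × j′ ≡ j

Far : Box → Box → Set
Far (i , j) (i′ , j′) = i ℤ.< i′ × j′ ℤ.< j

ahead-step : ∀ s p → Ahead s p (step s p)
ahead-step true  (i , j) = refl , pred-< j
ahead-step false (i , j) = <-succ i , refl

ahead-straight : ∀ s {p q} → Ahead s p q → Ahead s p (step s q)
ahead-straight true  (e , l) = e , ℤₚ.<-trans (pred-< _) l
ahead-straight false (l , e) = ℤₚ.<-trans l (<-succ _) , e

ahead-turn : ∀ s {p q} → Ahead s p q → Far p (step (not s) q)
ahead-turn true  (refl , l) = <-succ _ , l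
ahead-turn false (l , refl) = l , pred-< _

far-step : ∀ s {p q} → Far p q → Far p (step s q)
far-step true  (k , l) = k , ℤₚ.<-trans (pred-< _) l
far-step false (k , l) = ℤₚ.<-trans k (<-succ _) , l

module _ {m : ℕ} where

  compatible : Box × Letter m → Box × Letter m → Bool
  compatible b c = okPair b c ∧ okPair c b

  compatible-ahead : ∀ s {p q} (x y : Letter m) → Ahead s p q →
                     compatible (p , x) (q , y) ≡ canFollow s x (proj₁ y)
  compatible-ahead true {i , j} {_ , j′} (v , a) (u , b) (refl , j′<j)
    rewrite ==ℤ-refl i | <ℤ-false j′<j | <ℤ-true j′<j | ==ℤ-≢ (ℤₚ.<⇒≢ j′<j)
          | ==ℤ-≢ (ℤₚ.<⇒≢ j′<j ∘ sym) = row-rule v a u b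
  compatible-ahead false {i , j} {i′ , _} (v , a) (u , b) (i<i′ , refl)
    rewrite ==ℤ-refl j | <ℤ-false i<i′ | <ℤ-true i<i′ | ==ℤ-≢ (ℤₚ.<⇒≢ i<i′)
          | ==ℤ-≢ (ℤₚ.<⇒≢ i<i′ ∘ sym) = column-rule v a u b

  compatible-far : ∀ {p q} (x y : Letter m) → Far p q → compatible (p , x) (q , y) ≡ true
  compatible-far {i , j} {i′ , j′} x y (i<i′ , j′<j)
    rewrite ==ℤ-≢ (ℤₚ.<⇒≢ i<i′) | ==ℤ-≢ (ℤₚ.<⇒≢ i<i′ ∘ sym)
          | ==ℤ-≢ (ℤₚ.<⇒≢ j′<j) | ==ℤ-≢ (ℤₚ.<⇒≢ j′<j ∘ sym) = refl

  follows : Letter m → Word → List (Letter m) → Bool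
  follows x []      T       = true
  follows x (s ∷ w) []      = true
  follows x (s ∷ w) (y ∷ T) = canFollow s x (proj₁ y) ∧ follows y w T

  all-far : ∀ {p q} x w T → Far p q → allᵇ (compatible (p , x)) (zip (walk q w) T) ≡ true
  all-far x w       []      far = refl
  all-far x []      (y ∷ T) far rewrite compatible-far x y far = refl
  all-far x (s ∷ w) (y ∷ T) far rewrite compatible-far x y far = all-far x w T (far-step s far)

  -- The conjunct `follows y w T` on both sides acts as the assumption that the rest is filled
  -- correctly. Under it, compatibility with the next box implies compatibility with all later ones:
  -- along the straight segment by `canFollow-trans`, and from the first turn on because these boxes
  -- are `Far`.
  all-ahead : ∀ s {p q} x y w T → Ahead s p q →
    allᵇ (compatible (p , x)) (zip (walk q w) (y ∷ T)) ∧ follows y w T ≡ canFollow s x (proj₁ y) ∧ follows y w T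
  all-ahead s x y []      T  ahead rewrite compatible-ahead s x y ahead = cong (_∧ true) (Boolₚ.∧-identityʳ _)
  all-ahead s x y (t ∷ w) [] ahead rewrite compatible-ahead s x y ahead = cong (_∧ true) (Boolₚ.∧-identityʳ _)
  all-ahead s {p} {q} x y (t ∷ w) (z ∷ T) ahead rewrite compatible-ahead s x y ahead with canFollow s x (proj₁ y) in xy
  ... | false = refl
  ... | true with t Boolₚ.≟ s
  ...   | no t≢s rewrite Boolₚ.¬-not t≢s | all-far x w (z ∷ T) (ahead-turn s ahead) = refl
  ...   | yes refl with canFollow s y (proj₁ z) in yz
  ...     | false = Boolₚ.∧-zeroʳ _
  ...     | true  = trans (all-ahead s x z w T (ahead-straight s ahead))
                          (cong (_∧ follows z w T) (canFollow-trans s (proj₁ z) xy yz))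

  allPairsOK-walk : ∀ p w x T → allPairsOK (zip (walk p w) (x ∷ T)) ≡ follows x w T
  allPairsOK-walk p []      x T       = refl
  allPairsOK-walk p (s ∷ w) x []      = refl
  allPairsOK-walk p (s ∷ w) x (y ∷ T) = trans
    (cong (allᵇ (compatible (p , x)) (zip (walk (step s p) w) (y ∷ T)) ∧_) (allPairsOK-walk (step s p) w y T))
    (all-ahead s x y w T (ahead-step s p))

-- Words of compositions and of their concatenations

wordOf tailWord : List ℕ → Word
wordOf []       = []
wordOf (a ∷ as) = replicate (a ∸ 1) true ++ tailWord as
tailWord []       = []
tailWord (b ∷ bs) = false ∷ wordOf (b ∷ bs)

boxesAt-walk : ∀ r c a as → IsComp (a ∷ as) → boxesAt r c (a ∷ as) ≡ walk (r , c) (wordOf (a ∷ as))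
boxesAt-walk r c (suc a) as (_ ∷ comp) = trans
  (cong (map (λ t → (r , c ℤ.- + t)) (upTo (suc a)) ++_) (rest as comp))
  (row a c (λ t → t) (λ t → c ℤ.- + t) (λ _ → refl))
  where
  rest : ∀ as → IsComp as → boxesAt (r ℤ.+ + 1) (c ℤ.- + a) as ≡ walkTail (r , c ℤ.- + a) (tailWord as)
  rest []       []   = refl
  rest (b ∷ bs) comp = boxesAt-walk (r ℤ.+ + 1) (c ℤ.- + a) b bs comp
  next : ∀ c t → c ℤ.- + suc t ≡ (c ℤ.- + 1) ℤ.- + t
  next c t = lem c (+ t)
    where
    lem : ∀ c t → c ℤ.- (+ 1 ℤ.+ t) ≡ (c ℤ.- + 1) ℤ.- t
    lem = solve-∀
  row : ∀ a c (f : ℕ → ℕ) (g : ℕ → ℤ) → (∀ t → g (f t) ≡ c ℤ.- + t) →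
        map (λ t → (r , g t)) (applyUpTo f (suc a)) ++ walkTail (r , c ℤ.- + a) (tailWord as)
        ≡ walk (r , c) (replicate a true ++ tailWord as)
  row zero    c f g e rewrite e 0 | ℤₚ.+-identityʳ c = refl
  row (suc a) c f g e rewrite e 0 | ℤₚ.+-identityʳ c | next c a =
    cong ((r , c) ∷_) (row a (c ℤ.- + 1) (f ∘ suc) g (λ t → trans (e (suc t)) (next c t)))

wordOf-++ : ∀ d ds e es → wordOf ((d ∷ ds) ++ e ∷ es) ≡ wordOf (d ∷ ds) ++ false ∷ wordOf (e ∷ es)
wordOf-++ d []        e es = cong (_++ false ∷ wordOf (e ∷ es)) (sym (Listₚ.++-identityʳ (replicate (d ∸ 1) true)))
wordOf-++ d (d′ ∷ ds) e es = trans (cong (λ w → replicate (d ∸ 1) true ++ false ∷ w) (wordOf-++ d′ ds e es))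
  (sym (Listₚ.++-assoc (replicate (d ∸ 1) true) (false ∷ wordOf (d′ ∷ ds)) _))

wordOf-nearConcat : ∀ d ds e es → IsComp (d ∷ ds) → IsComp (e ∷ es) →
  wordOf (nearConcat (d ∷ ds) (e ∷ es)) ≡ wordOf (d ∷ ds) ++ true ∷ wordOf (e ∷ es)
wordOf-nearConcat (suc d) [] (suc e) es (s≤s _ ∷ _) (s≤s _ ∷ _) = trans (join d)
  (cong (_++ true ∷ wordOf (suc e ∷ es)) (sym (Listₚ.++-identityʳ (replicate d true))))
  where
  join : ∀ d → replicate (d ℕ.+ suc e) true ++ tailWord es ≡ replicate d true ++ true ∷ wordOf (suc e ∷ es)
  join zero    = refl
  join (suc d) = cong (true ∷_) (join d)
wordOf-nearConcat d (d′ ∷ ds) e es (_ ∷ comp) comp′ = trans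
  (cong (replicate (d ∸ 1) true ++_) (tail d′ ds comp))
  (sym (Listₚ.++-assoc (replicate (d ∸ 1) true) (false ∷ wordOf (d′ ∷ ds)) _))
  where
  tail : ∀ d ds → IsComp (d ∷ ds) →
         tailWord (nearConcat (d ∷ ds) (e ∷ es)) ≡ (false ∷ wordOf (d ∷ ds)) ++ true ∷ wordOf (e ∷ es)
  tail d []        comp = cong (false ∷_) (wordOf-nearConcat d [] e es comp comp′)
  tail d (d″ ∷ ds) comp = cong (false ∷_) (wordOf-nearConcat d (d″ ∷ ds) e es comp comp′)

nearConcat-comp : ∀ {D E} → IsComp D → IsComp E → IsComp (nearConcat D E)
nearConcat-comp {[]}          {E}     []         compE       = compE
nearConcat-comp {b ∷ []}      {[]}    comp       compE       = comp
nearConcat-comp {b ∷ []}      {g ∷ E} (1≤b ∷ _)  (_ ∷ compE) = ℕₚ.m≤n⇒m≤n+o g 1≤b ∷ compE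
nearConcat-comp {b ∷ b′ ∷ D}  {E}     (1≤b ∷ cD) compE       = 1≤b ∷ nearConcat-comp {b′ ∷ D} cD compE

-- The index of the diagonal of a box, unrelated to the content of a tableau.
content : Box → ℤ
content (i , j) = j ℤ.- i

content-step : ∀ s p → content (step s p) ℤ.< content p
content-step true  (i , j) = subst (ℤ._< j ℤ.- i) (lem i j) (pred-< (j ℤ.- i))
  where
  lem : ∀ i j → (j ℤ.- i) ℤ.- + 1 ≡ (j ℤ.- + 1) ℤ.- i
  lem = solve-∀
content-step false (i , j) = subst (ℤ._< j ℤ.- i) (lem i j) (pred-< (j ℤ.- i))
  where
  lem : ∀ i j → (j ℤ.- i) ℤ.- + 1 ≡ j ℤ.- (i ℤ.+ + 1)
  lem = solve-∀

∈-walkTail : ∀ {p z} w → z ∈ walkTail p w → content z ℤ.< content p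
∈-walkTail {p} (s ∷ w) (here refl) = content-step s p
∈-walkTail {p} (s ∷ w) (there z∈)  = ℤₚ.<-trans (∈-walkTail w z∈) (content-step s p)

-- The content strictly decreases along a walk, so the set of boxes determines their order.
walk-injective : ∀ p w p′ w′ → SameSet (walk p w) (walk p′ w′) → p ≡ p′ × w ≡ w′
walk-injective p w p′ w′ same = p≡p′ , w≡w′ w w′ tails
  where
  p≡p′ : p ≡ p′
  p≡p′ with proj₁ (same p) (here refl) | proj₂ (same p′) (here refl)
  ... | here e    | _          = e
  ... | _         | here e     = sym e
  ... | there p∈  | there p′∈  = ⊥-elim (ℤₚ.<-asym (∈-walkTail w′ p∈) (∈-walkTail w p′∈))
  tails : SameSet (walkTail p w) (walkTail p′ w′)
  tails z = (λ z∈ → drop (∈-walkTail w z∈) (sym p≡p′) (proj₁ (same z) (there z∈)))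
          , (λ z∈ → drop (∈-walkTail w′ z∈) p≡p′ (proj₂ (same z) (there z∈)))
    where
    drop : ∀ {z q q′ L} → content z ℤ.< content q → q′ ≡ q → z ∈ q′ ∷ L → z ∈ L
    drop z<q refl (here refl) = ⊥-elim (ℤₚ.<-irrefl refl z<q)
    drop z<q _    (there z∈)  = z∈
  step-injective : ∀ s s′ → step s p ≡ step s′ p → s ≡ s′
  step-injective true  true  e = refl
  step-injective false false e = refl
  step-injective true  false e = contradiction (cong proj₂ e) (ℤₚ.<⇒≢ (pred-< (proj₂ p)))
  step-injective false true  e = contradiction (sym (cong proj₁ e)) (ℤₚ.<⇒≢ (<-succ (proj₁ p)))
  w≡w′ : ∀ w w′ → SameSet (walkTail p w) (walkTail p′ w′) → w ≡ w′
  w≡w′ []      []        t = refl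
  w≡w′ []      (s ∷ w′)  t = contradiction (proj₂ (t _) (here refl)) λ ()
  w≡w′ (s ∷ w) []        t = contradiction (proj₁ (t _) (here refl)) λ ()
  w≡w′ (s ∷ w) (s′ ∷ w′) t with walk-injective (step s p) w (step s′ p′) w′ t
  ... | e , refl = cong (_∷ w) (step-injective s s′ (trans e (cong (step s′) (sym p≡p′))))

-- Words of transposed and rotated ribbons

end : Box → Word → Box
end p []      = p
end p (s ∷ w) = end (step s p) w

end-++ : ∀ p u t → end p (u ++ t ∷ []) ≡ step t (end p u)
end-++ p []      t = refl
end-++ p (s ∷ u) t = end-++ (step s p) u t

walk-++ : ∀ p u t → walk p (u ++ t ∷ []) ≡ walk p u ++ step t (end p u) ∷ []
walk-++ p []      t = refl
walk-++ p (s ∷ u) t = cong (p ∷_) (walk-++ (step s p) u t)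

module _ (τ : Box → Box) (φ : Bool → Bool) (undo : ∀ s p → step (φ s) (τ (step s p)) ≡ τ p) where

  -- By `undo`, a forward step `s` becomes a backward step `φ s` under `τ`, so the image is a walk
  -- when read from its last box. The second component locates the end of the new walk, which is
  -- where the induction appends one more step.
  reverse-walk : ∀ p w → reverse (map τ (walk p w)) ≡ walk (τ (end p w)) (reverse (map φ w))
                       × end (τ (end p w)) (reverse (map φ w)) ≡ τ p
  reverse-walk p []      = refl , refl
  reverse-walk p (s ∷ w) with reverse-walk (step s p) w
  ... | boxes≡ , end≡ = trans (Listₚ.unfold-reverse (τ p) (map τ (walk (step s p) w)))
          (trans (cong₂ (λ L z → L ++ z ∷ []) boxes≡ (sym last))
          (trans (sym (walk-++ p′ (reverse (map φ w)) (φ s))) (cong (walk p′) (sym (Listₚ.unfold-reverse (φ s) (map φ w))))))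
      , trans (cong (end p′) (Listₚ.unfold-reverse (φ s) (map φ w)))
          (trans (end-++ p′ (reverse (map φ w)) (φ s)) last)
    where
    p′ : Box
    p′ = τ (end (step s p) w)
    last : step (φ s) (end p′ (reverse (map φ w))) ≡ τ p
    last = trans (cong (step (φ s)) end≡) (undo s p)

  -- `Transposed` and `Rotated` provide only an equality of sets up to translation. Both sets are
  -- traversed by walks, so `walk-injective` yields equal words, whatever the starting boxes are.
  image-word : ∀ d ds E → IsComp (d ∷ ds) → IsComp E → SameSet (boxes E) (map τ (boxes (d ∷ ds))) →
               E ≢ [] × wordOf E ≡ reverse (map φ (wordOf (d ∷ ds)))
  image-word d ds E compD compE same rewrite boxesAt-walk (+ 0) (+ 0) d ds compD with E
  ... | []     = contradiction (proj₂ (same _) (here refl)) λ ()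
  ... | e ∷ es = (λ ()) , proj₂ (walk-injective _ _ _ _ same′)
    where
    o : Box
    o = + 0 , + 0
    w : Word
    w = wordOf (d ∷ ds)
    same′ : SameSet (walk o (wordOf (e ∷ es))) (walk (τ (end o w)) (reverse (map φ w)))
    same′ z rewrite sym (boxesAt-walk (+ 0) (+ 0) e es compE) | sym (proj₁ (reverse-walk o w)) =
      (λ z∈ → Anyₚ.reverse⁺ (proj₁ (same z) z∈)) , (λ z∈ → proj₂ (same z) (Anyₚ.reverse⁻ z∈))

transposed-word : ∀ d ds E → IsComp (d ∷ ds) → Transposed (d ∷ ds) E →
                  E ≢ [] × wordOf E ≡ reverse (map not (wordOf (d ∷ ds)))
transposed-word d ds E compD (compE , a , b , same) =
  image-word τ not undo d ds E compD compE same
  where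
  τ : Box → Box
  τ (i , j) = (j ℤ.+ a , i ℤ.+ b)
  undo : ∀ s p → step (not s) (τ (step s p)) ≡ τ p
  undo true  (i , j) = cong (_, i ℤ.+ b) (lem j a)
    where
    lem : ∀ j a → ((j ℤ.- + 1) ℤ.+ a) ℤ.+ + 1 ≡ j ℤ.+ a
    lem = solve-∀
  undo false (i , j) = cong (j ℤ.+ a ,_) (lem i b)
    where
    lem : ∀ i b → ((i ℤ.+ + 1) ℤ.+ b) ℤ.- + 1 ≡ i ℤ.+ b
    lem = solve-∀

rotated-word : ∀ d ds E → IsComp (d ∷ ds) → Rotated (d ∷ ds) E →
               E ≢ [] × wordOf E ≡ reverse (map (λ s → s) (wordOf (d ∷ ds)))
rotated-word d ds E compD (compE , a , b , same) =
  image-word τ (λ s → s) undo d ds E compD compE same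
  where
  τ : Box → Box
  τ (i , j) = (a ℤ.- i , b ℤ.- j)
  undo : ∀ s p → step s (τ (step s p)) ≡ τ p
  undo true  (i , j) = cong (a ℤ.- i ,_) (lem j b)
    where
    lem : ∀ j b → (b ℤ.- (j ℤ.- + 1)) ℤ.- + 1 ≡ b ℤ.- j
    lem = solve-∀
  undo false (i , j) = cong (_, b ℤ.- j) (lem i a)
    where
    lem : ∀ i a → (a ℤ.- (i ℤ.+ + 1)) ℤ.+ + 1 ≡ a ℤ.- i
    lem = solve-∀

-- Coefficients of ribbon functions and of power sums

allᵇ-cong : ∀ {A : Set} {p r : A → Bool} xs → (∀ x → p x ≡ r x) → allᵇ p xs ≡ allᵇ r xs
allᵇ-cong []       e = refl
allᵇ-cong (x ∷ xs) e = cong₂ _∧_ (e x) (allᵇ-cong xs e)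

allPairs-reverse : ∀ {A : Set} {R : A → A → Set} {xs} → AllPairs R xs → AllPairs (flip R) (reverse xs)
allPairs-reverse {xs = []}     []       = []
allPairs-reverse {R = R} {xs = x ∷ xs} (p ∷ ps) rewrite Listₚ.unfold-reverse x xs =
  AllPairsₚ.++⁺ (allPairs-reverse ps) ([] ∷ []) (All.tabulate (λ z∈ → All.lookup p (Anyₚ.reverse⁻ z∈) ∷ []))

module Monomials (m : ℕ) where
  open Polynomials m public
  open Sums ℚ-semiring

  variablePower : Fin m → ℕ → Exponent
  variablePower v k = tabulate (λ i → if v ==F i then k else 0)

  variable′ : Fin m → Poly
  variable′ v = monomial (variablePower v 1)

  lookup-variablePower : ∀ v k i → lookup (variablePower v k) i ≡ (if v ==F i then k else 0)
  lookup-variablePower v k i = Vecₚ.lookup∘tabulate _ i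

  variablePower-⊕ : ∀ v j k → variablePower v j ⊕ variablePower v k ≡ variablePower v (j ℕ.+ k)
  variablePower-⊕ v j k = trans (zip-tabulate _ _) (Vecₚ.tabulate-cong (λ i → merge (v ==F i)))
    where
    zip-tabulate : ∀ {n} (f g : Fin n → ℕ) → Vec.zipWith ℕ._+_ (tabulate f) (tabulate g) ≡ tabulate (λ i → f i ℕ.+ g i)
    zip-tabulate {zero}  f g = refl
    zip-tabulate {suc n} f g = cong (f Fin.zero ℕ.+ g Fin.zero Vec.∷_) (zip-tabulate (f ∘ Fin.suc) (g ∘ Fin.suc))
    merge : ∀ b → (if b then j else 0) ℕ.+ (if b then k else 0) ≡ (if b then j ℕ.+ k else 0)
    merge true  = refl
    merge false = refl

  hasExponent : (Fin m → ℕ) → Exponent → Bool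
  hasExponent a e = allᵇ (λ i → lookup e i ℕ.≡ᵇ a i) (allFin m)

  coefficient : Poly → (Fin m → ℕ) → ℚ
  coefficient p a = eval p (λ e → [ hasExponent a e ]· 1ℚ)

  open Ribbons poly-semiring variable′ (allFin m) canFollow (λ _ _ → refl) public
    using (after; from; ⟪_⟫; straight; Sorted; newton; module Identities)

  contentVec : List (Letter m) → Exponent
  contentVec []            = Vec.replicate m 0
  contentVec ((v , _) ∷ T) = variablePower v 1 ⊕ contentVec T

  contentIs-contentVec : ∀ T a → contentIs T a ≡ hasExponent a (contentVec T)
  contentIs-contentVec T a = allᵇ-cong (allFin m) (λ i → cong (ℕ._≡ᵇ a i) (count i _ (λ v b → refl) T))
    where
    count : ∀ i (p : Letter m → Bool) → (∀ v b → p (v , b) ≡ v ==F i) →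
            ∀ T → length (filterᵇ p T) ≡ lookup (contentVec T) i
    count i p e [] = sym (Vecₚ.lookup-replicate i 0)
    count i p e ((v , b) ∷ T)
      rewrite Vecₚ.lookup-zipWith ℕ._+_ i (variablePower v 1) (contentVec T) | lookup-variablePower v 1 i
      with p (v , b) | v ==F i | e v b
    ... | true  | true  | _ = cong suc (count i p e T)
    ... | false | false | _ = count i p e T

  ∑-letters : ∀ g → ∑ (letters m) g ≡ ∑ (allFin m) (λ v → g (v , true) ℚ.+ g (v , false))
  ∑-letters g = go (allFin m)
    where
    go : ∀ vs → ∑ (cartesianProduct vs (true ∷ false ∷ [])) g ≡ ∑ vs (λ v → g (v , true) ℚ.+ g (v , false))
    go []       = refl
    go (v ∷ vs) = trans (cong (λ z → g (v , true) ℚ.+ (g (v , false) ℚ.+ z)) (go vs))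
      (sym (ℚₚ.+-assoc (g (v , true)) (g (v , false)) _))

  ∑-listsOf : ∀ {A : Set} (xs : List A) n (g : List A → ℚ) →
              ∑ (listsOf xs (suc n)) g ≡ ∑ xs (λ x → ∑ (listsOf xs n) (λ T → g (x ∷ T)))
  ∑-listsOf xs n g = trans (∑-concatMap _ xs g) (∑-cong xs (λ x → ∑-map (x ∷_) (listsOf xs n) g))

  eval-guard : ∀ b p f → eval (Sums.[_]·_ poly-semiring b p) f ≡ [ b ]· eval p f
  eval-guard true  p f = refl
  eval-guard false p f = refl

  -- The functional `f` is arbitrary rather than a coefficient extraction: splitting off the first
  -- letter replaces it by the shifted functional `f′`, so the induction needs all of them.
  eval-after : ∀ w l f →
    ∑ (listsOf (letters m) (length w)) (λ T → [ follows l w T ]· f (contentVec T)) ≡ eval (after w l) f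
  eval-from : ∀ w v f →
    ∑ (listsOf (letters m) (length w)) (λ T → [ follows (v , true) w T ]· f (variablePower v 1 ⊕ contentVec T)) ℚ.+
    ∑ (listsOf (letters m) (length w)) (λ T → [ follows (v , false) w T ]· f (variablePower v 1 ⊕ contentVec T))
    ≡ eval (from w v) f

  eval-after [] l f = trans (ℚₚ.+-identityʳ _) (sym (eval-1 f))
  eval-after (s ∷ w) l f = begin
    ∑ (listsOf (letters m) (suc (length w))) (λ T → [ follows l (s ∷ w) T ]· f (contentVec T))
      ≡⟨ trans (∑-listsOf (letters m) (length w) _) (∑-letters _) ⟩
    ∑ (allFin m) (λ v → branch v true ℚ.+ branch v false)
      ≡⟨ ∑-cong (allFin m) (λ v → cong₂ ℚ._+_ (pull v true) (pull v false)) ⟩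
    ∑ (allFin m) (λ v → [ canFollow s l v ]· inner v true ℚ.+ [ canFollow s l v ]· inner v false)
      ≡⟨ ∑-cong (allFin m) (λ v → trans (sym ([]·-+ (canFollow s l v) (inner v true) (inner v false)))
            (trans ([]·-cong (canFollow s l v) (eval-from w v f))
                     (sym (eval-guard (canFollow s l v) (from w v) f)))) ⟩
    ∑ (allFin m) (λ v → eval (Sums.[_]·_ poly-semiring (canFollow s l v) (from w v)) f)
      ≡⟨ eval-∑ (allFin m) _ f ⟨
    eval (after (s ∷ w) l) f ∎
    where
    open ≡-Reasoning
    inner branch : Fin m → Bool → ℚ
    inner v b  = ∑ (listsOf (letters m) (length w)) (λ T → [ follows (v , b) w T ]· f (variablePower v 1 ⊕ contentVec T))
    branch v b = ∑ (listsOf (letters m) (length w))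
      (λ T → [ canFollow s l v ∧ follows (v , b) w T ]· f (variablePower v 1 ⊕ contentVec T))
    pull : ∀ v b → branch v b ≡ [ canFollow s l v ]· inner v b
    pull v b = trans (∑-cong (listsOf (letters m) (length w)) (λ T → []·-∧ (canFollow s l v) (follows (v , b) w T) _))
      (sym ([]·-∑ (canFollow s l v) (listsOf (letters m) (length w)) _))

  eval-from w v f = trans (cong₂ ℚ._+_ (eval-after w (v , true) f′) (eval-after w (v , false) f′)) (begin
    eval (after w (v , true)) f′ ℚ.+ eval (after w (v , false)) f′
      ≡⟨ eval-+ (after w (v , true)) (after w (v , false)) f′ ⟨
    eval (after w (v , true) +ₚ after w (v , false)) f′
      ≡⟨ eval-monomial-* (variablePower v 1) (after w (v , true) +ₚ after w (v , false)) f ⟨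
    eval (from w v) f ∎)
    where
    open ≡-Reasoning
    f′ : Exponent → ℚ
    f′ e = f (variablePower v 1 ⊕ e)

  rcoeff-word : ∀ d ds a → IsComp (d ∷ ds) → toℚ (rcoeff (d ∷ ds) m a) ≡ coefficient ⟪ wordOf (d ∷ ds) ⟫ a
  rcoeff-word d ds a comp rewrite boxesAt-walk (+ 0) (+ 0) d ds comp = begin
    toℚ (length (filterᵇ (ok o w) (listsOf (letters m) (suc (length (walkTail o w))))))
      ≡⟨ cong (λ n → toℚ (length (filterᵇ (ok o w) (listsOf (letters m) (suc n))))) (length-walkTail o w) ⟩
    toℚ (length (filterᵇ (ok o w) (listsOf (letters m) (suc (length w)))))
      ≡⟨ toℚ-length-filter (ok o w) (listsOf (letters m) (suc (length w))) ⟩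
    ∑ (listsOf (letters m) (suc (length w))) (λ T → [ ok o w T ]· 1ℚ)
      ≡⟨ trans (∑-listsOf (letters m) (length w) _) (∑-cong (letters m) λ x →
           ∑-cong (listsOf (letters m) (length w)) λ T → split x T) ⟩
    ∑ (letters m) (λ x → ∑ (listsOf (letters m) (length w)) (λ T → [ follows x w T ]· δ (contentVec (x ∷ T))))
      ≡⟨ trans (∑-letters _) (∑-cong (allFin m) (λ v → eval-from w v δ)) ⟩
    ∑ (allFin m) (λ v → eval (from w v) δ)
      ≡⟨ eval-∑ (allFin m) (from w) δ ⟨
    coefficient ⟪ w ⟫ a ∎
    where
    open ≡-Reasoning
    o : Box
    o = + 0 , + 0
    w : Word
    w = wordOf (d ∷ ds)
    ok : Box → Word → List (Letter m) → Bool
    ok p w T = allPairsOK (zip (walk p w) T) ∧ contentIs T a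
    δ : Exponent → ℚ
    δ e = [ hasExponent a e ]· 1ℚ
    length-walkTail : ∀ p w → length (walkTail p w) ≡ length w
    length-walkTail p []      = refl
    length-walkTail p (s ∷ w) = cong suc (length-walkTail (step s p) w)
    split : ∀ x T → [ ok o w (x ∷ T) ]· 1ℚ ≡ [ follows x w T ]· δ (contentVec (x ∷ T))
    split x T = trans (cong₂ (λ b c → [ b ∧ c ]· 1ℚ) (allPairsOK-walk o w x T) (contentIs-contentVec (x ∷ T) a))
      ([]·-∧ (follows x w T) (hasExponent a (contentVec (x ∷ T))) 1ℚ)

  powerSum : ℕ → Poly
  powerSum k = Sums.∑ poly-semiring (allFin m) (λ v → monomial (variablePower v k))

  powerSumProduct : List ℕ → Poly
  powerSumProduct []       = 1ₚ
  powerSumProduct (k ∷ ks) = powerSum k *ₚ powerSumProduct ks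

  pcoeff-powerSumProduct : ∀ ks a → toℚ (pcoeff ks m a) ≡ coefficient (powerSumProduct ks) a
  pcoeff-powerSumProduct ks a = trans (toℚ-length-filter (λ F → weightIs ks F a) (listsOf (allFin m) (length ks)))
    (trans (∑-cong (listsOf (allFin m) (length ks)) (λ F → cong ([_]· 1ℚ) (weightIs-weight ks F)))
             (expand ks _))
    where
    weight : List ℕ → List (Fin m) → Exponent
    weight (k ∷ ks) (v ∷ F) = variablePower v k ⊕ weight ks F
    weight _        _       = Vec.replicate m 0
    weightIs-weight : ∀ ks F → weightIs ks F a ≡ hasExponent a (weight ks F)
    weightIs-weight ks F = allᵇ-cong (allFin m) (λ i → cong (ℕ._≡ᵇ a i) (total i _ (λ l v → refl) ks F))
      where
      total : ∀ i (h : ℕ × Fin m → ℕ) → (∀ l v → h (l , v) ≡ (if v ==F i then l else 0)) →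
              ∀ ks F → foldr ℕ._+_ 0 (map h (zip ks F)) ≡ lookup (weight ks F) i
      total i h e []       []      = sym (Vecₚ.lookup-replicate i 0)
      total i h e []       (v ∷ F) = sym (Vecₚ.lookup-replicate i 0)
      total i h e (k ∷ ks) []      = sym (Vecₚ.lookup-replicate i 0)
      total i h e (k ∷ ks) (v ∷ F)
        rewrite Vecₚ.lookup-zipWith ℕ._+_ i (variablePower v k) (weight ks F) | lookup-variablePower v k i
        = cong₂ ℕ._+_ (e k v) (total i h e ks F)
    expand : ∀ ks f → ∑ (listsOf (allFin m) (length ks)) (λ F → f (weight ks F)) ≡ eval (powerSumProduct ks) f
    expand []       f = trans (ℚₚ.+-identityʳ _) (sym (eval-1 f))
    expand (k ∷ ks) f = begin
      ∑ (listsOf (allFin m) (suc (length ks))) (λ F → f (weight (k ∷ ks) F))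
        ≡⟨ ∑-listsOf (allFin m) (length ks) _ ⟩
      ∑ (allFin m) (λ v → ∑ (listsOf (allFin m) (length ks)) (λ F → f (variablePower v k ⊕ weight ks F)))
        ≡⟨ ∑-cong (allFin m) (λ v → expand ks (λ e → f (variablePower v k ⊕ e))) ⟩
      ∑ (allFin m) (λ v → eval (powerSumProduct ks) (λ e → f (variablePower v k ⊕ e)))
        ≡⟨ ∑-cong (allFin m) (λ v → trans (ℚₚ.+-identityʳ _) (ℚₚ.*-identityˡ _)) ⟨
      ∑ (allFin m) (λ v → eval (monomial (variablePower v k)) (λ e → eval (powerSumProduct ks) (λ e′ → f (e ⊕ e′))))
        ≡⟨ eval-∑ (allFin m) (λ v → monomial (variablePower v k)) _ ⟨
      eval (powerSum k) (λ e → eval (powerSumProduct ks) (λ e′ → f (e ⊕ e′)))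
        ≡⟨ eval-* (powerSum k) (powerSumProduct ks) f ⟨
      eval (powerSumProduct (k ∷ ks)) f ∎
      where open ≡-Reasoning

  -- Values weakly decrease to the left and weakly increase downwards, hence the reversed list of
  -- variables here and the unreversed one in `downwards`.
  leftwards : Sorted true (reverse (allFin m))
  leftwards = record
    { perm    = ↭-reverse (allFin m)
    ; repeats = λ v → canFollow-≡ v false
    ; stops   = λ v → canFollow-≡ v true
    ; ordered = allPairs-reverse (AllPairsₚ.tabulate⁺-< (λ i<j mk → canFollow-> mk i<j , canFollow-< mk i<j))
    }

  downwards : Sorted false (allFin m)
  downwards = record
    { perm    = Perm.↭-refl
    ; repeats = λ v → cong not (canFollow-≡ v true)
    ; stops   = λ v → cong not (canFollow-≡ v false)
    ; ordered = AllPairsₚ.tabulate⁺-< (λ i<j mk → cong not (canFollow-< mk i<j) , cong not (canFollow-> mk i<j))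
    }

  open Identities +ₚ-cancelʳ ×ₚ-torsionFree leftwards downwards public
    using (⟪⟫-reverse; doubling; straight₁; tri₃; P≥₃; newton-tri₃)

-- Positivity in the power sum basis

module R (m : ℕ) = CommutativeSemiring (Polynomials.poly-semiring m)

-- A symmetric function is represented by its restrictions to finitely many variables, one for each
-- `m`.
Family : Set
Family = ∀ m → Monomials.Poly m

infix  4 _≈ᶠ_
infixl 6 _+ᶠ_
infixl 7 _*ᶠ_
infixr 7 _•ᶠ_

_≈ᶠ_ : Family → Family → Set
f ≈ᶠ g = ∀ m → R._≈_ m (f m) (g m)

_+ᶠ_ _*ᶠ_ : Family → Family → Family
(f +ᶠ g) m = R._+_ m (f m) (g m)
(f *ᶠ g) m = R._*_ m (f m) (g m)

_•ᶠ_ : ℚ → Family → Family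
(c •ᶠ f) m = Monomials._•_ m c (f m)

0ᶠ 1ᶠ : Family
0ᶠ m = R.0# m
1ᶠ m = R.1# m

powers : List ℕ → Family
powers λs m = Monomials.powerSumProduct m λs

•-* : ∀ c f g → (c •ᶠ f) *ᶠ g ≈ᶠ c •ᶠ (f *ᶠ g)
•-* c p r m = pointwise λ f → begin
  eval ((c • p m) *ₚ r m) f                                ≡⟨ eval-* (c • p m) (r m) f ⟩
  eval (c • p m) (λ e → eval (r m) (λ e′ → f (e ⊕ e′)))    ≡⟨ eval-• c (p m) _ ⟩
  c ℚ.* eval (p m) (λ e → eval (r m) (λ e′ → f (e ⊕ e′)))  ≡⟨ cong (c ℚ.*_) (eval-* (p m) (r m) f) ⟨
  c ℚ.* eval (p m *ₚ r m) f                                ≡⟨ eval-• c (p m *ₚ r m) f ⟨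
  eval (c • (p m *ₚ r m)) f                                ∎
  where
  open Monomials m
  open ≡-Reasoning

•-cong : ∀ c {f g} → f ≈ᶠ g → c •ᶠ f ≈ᶠ c •ᶠ g
•-cong c {p} {r} h m = pointwise λ f →
  trans (eval-• c (p m) f) (trans (cong (c ℚ.*_) (at (h m) f)) (sym (eval-• c (r m) f)))
  where open Monomials m

•-• : ∀ c d f → c •ᶠ d •ᶠ f ≈ᶠ (c ℚ.* d) •ᶠ f
•-• c d p m = pointwise λ f → trans (eval-• c (d • p m) f) (trans (cong (c ℚ.*_) (eval-• d (p m) f))
  (trans (sym (ℚₚ.*-assoc c d (eval (p m) f))) (sym (eval-• (c ℚ.* d) (p m) f))))
  where open Monomials m

•-+ : ∀ c f g → c •ᶠ (f +ᶠ g) ≈ᶠ c •ᶠ f +ᶠ c •ᶠ g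
•-+ c f g m = R.reflexive m (Listₚ.map-++ _ (f m) (g m))

•-1 : ∀ f → 1ℚ •ᶠ f ≈ᶠ f
•-1 p m = pointwise λ f → trans (eval-• 1ℚ (p m) f) (ℚₚ.*-identityˡ _)
  where open Monomials m

powers-++ : ∀ λs μs → powers (λs ++ μs) ≈ᶠ powers λs *ᶠ powers μs
powers-++ []       μs m = R.sym m (R.*-identityˡ m _)
powers-++ (k ∷ λs) μs m = R.trans m (R.*-congˡ m {x = Monomials.powerSum m k} (powers-++ λs μs m))
  (R.sym m (R.*-assoc m (Monomials.powerSum m k) _ _))

Combination : Set
Combination = List (List ℕ × ℚ)

Nonnegative : List ℕ × ℚ → Set
Nonnegative (λs , c) = IsComp λs × 0ℚ ℚ.≤ c

expand : Combination → Family
expand []             = 0ᶠ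
expand ((λs , c) ∷ L) = c •ᶠ powers λs +ᶠ expand L

-- p-positivity, with one expansion for all numbers of variables
Positive : Family → Set
Positive f = Σ Combination λ L → All Nonnegative L × f ≈ᶠ expand L

positive-resp : ∀ {f g} → f ≈ᶠ g → Positive g → Positive f
positive-resp e (L , nonneg , h) = L , nonneg , λ m → R.trans m (e m) (h m)

positive-0 : Positive 0ᶠ
positive-0 = [] , [] , λ m → R.refl m

positive-powers : ∀ λs → IsComp λs → ∀ {c} → 0ℚ ℚ.≤ c → Positive (c •ᶠ powers λs)
positive-powers λs comp {c} 0≤c = (λs , c) ∷ [] , (comp , 0≤c) ∷ [] , λ m → R.sym m (R.+-identityʳ m _)

positive-1 : Positive 1ᶠ
positive-1 = positive-resp (λ m → R.sym m (•-1 1ᶠ m)) (positive-powers [] [] (ℚₚ.nonNegative⁻¹ 1ℚ))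

positive-p : ∀ k → 1 ≤ k → Positive (λ m → Monomials.powerSum m k)
positive-p k 1≤k = positive-resp
  (λ m → R.sym m (R.trans m (•-1 (powers (k ∷ [])) m) (R.*-identityʳ m (Monomials.powerSum m k))))
  (positive-powers (k ∷ []) (1≤k ∷ []) (ℚₚ.nonNegative⁻¹ 1ℚ))

positive-+ : ∀ {f g} → Positive f → Positive g → Positive (f +ᶠ g)
positive-+ (L , nonneg , h) (M , nonneg′ , k) = L ++ M , Allₚ.++⁺ nonneg nonneg′ , λ m →
  R.trans m (R.+-cong m (h m) (k m)) (R.sym m (expand-++ L M m))
  where
  expand-++ : ∀ L M → expand (L ++ M) ≈ᶠ expand L +ᶠ expand M
  expand-++ []             M m = R.refl m
  expand-++ ((λs , c) ∷ L) M m = R.trans m (R.+-congˡ m {(c •ᶠ powers λs) m} (expand-++ L M m))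
    (R.sym m (R.+-assoc m ((c •ᶠ powers λs) m) (expand L m) (expand M m)))

0≤-* : ∀ {c d} → 0ℚ ℚ.≤ c → 0ℚ ℚ.≤ d → 0ℚ ℚ.≤ c ℚ.* d
0≤-* {c} {d} 0≤c 0≤d = subst (ℚ._≤ c ℚ.* d) (ℚₚ.*-zeroʳ c)
  (ℚₚ.*-monoˡ-≤-nonNeg c {{ℚ.nonNegative 0≤c}} 0≤d)

positive-• : ∀ {f c} → 0ℚ ℚ.≤ c → Positive f → Positive (c •ᶠ f)
positive-• {f} {c} 0≤c (L , nonneg , h) = positive-resp (•-cong c h) (scaled L nonneg)
  where
  scaled : ∀ L → All Nonnegative L → Positive (c •ᶠ expand L)
  scaled []             []                  = positive-0
  scaled ((λs , d) ∷ L) ((comp , 0≤d) ∷ ns) = positive-resp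
    (λ m → R.trans m (•-+ c (d •ᶠ powers λs) (expand L) m) (R.+-congʳ m (•-• c d (powers λs) m)))
    (positive-+ (positive-powers λs comp (0≤-* 0≤c 0≤d)) (scaled L ns))

positive-* : ∀ {f g} → Positive f → Positive g → Positive (f *ᶠ g)
positive-* {f} {g} (L , nonneg , h) (M , nonneg′ , k) =
  positive-resp (λ m → R.*-cong m (h m) (k m)) (outer L nonneg)
  where
  inner : ∀ λs → IsComp λs → ∀ M → All Nonnegative M → Positive (expand M *ᶠ powers λs)
  inner λs comp [] [] = positive-0
  inner λs comp ((μs , d) ∷ M) ((comp′ , 0≤d) ∷ ns) = positive-resp
    (λ m → R.trans m (R.distribʳ m (powers λs m) ((d •ᶠ powers μs) m) (expand M m))
      (R.+-congʳ m (R.trans m (•-* d (powers μs) (powers λs) m) (•-cong d (λ m → R.sym m (powers-++ μs λs m)) m))))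
    (positive-+ (positive-powers (μs ++ λs) (Allₚ.++⁺ comp′ comp) 0≤d) (inner λs comp M ns))
  outer : ∀ L → All Nonnegative L → Positive (expand L *ᶠ expand M)
  outer [] [] = positive-0
  outer ((λs , c) ∷ L) ((comp , 0≤c) ∷ ns) = positive-resp
    (λ m → R.trans m (R.distribʳ m (expand M m) ((c •ᶠ powers λs) m) (expand L m))
      (R.+-congʳ m (R.trans m (•-* c (powers λs) (expand M) m) (•-cong c (λ m → R.*-comm m (powers λs m) (expand M m)) m))))
    (positive-+ (positive-• 0≤c (inner λs comp M nonneg′)) (outer L ns))

infixr 7 _×ᶠ_
_×ᶠ_ : ℕ → Family → Family
(n ×ᶠ f) m = SRMult._×_ (R.semiring m) n (f m)

positive-÷ : ∀ {f g} n → suc n ×ᶠ f ≈ᶠ g → Positive g → Positive f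
positive-÷ {p} {r} n h pos = positive-resp divide (positive-• (unitFraction-≥0 n) pos)
  where
  divide : p ≈ᶠ unitFraction n •ᶠ r
  divide m = pointwise λ f → sym (begin
    eval (unitFraction n • r m) f                             ≡⟨ eval-• (unitFraction n) (r m) f ⟩
    unitFraction n ℚ.* eval (r m) f                           ≡⟨ cong (unitFraction n ℚ.*_) (at (h m) f) ⟨
    unitFraction n ℚ.* eval ((suc n ×ᶠ p) m) f                ≡⟨ cong (unitFraction n ℚ.*_) (eval-× (suc n) (p m) f) ⟩
    unitFraction n ℚ.* (suc n ×ℚ eval (p m) f)                ≡⟨ unitFraction-×ℚ n (eval (p m) f) ⟩
    eval (p m) f                                              ∎)
    where
    open Monomials m
    open ≡-Reasoning

Series : Set
Series = ∀ m → Streams.Stream (Polynomials.poly-semiring m)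

PositiveAt : Series → ℕ → Set
PositiveAt F n = Positive (λ m → F m n)

conv : Series → Series → Series
conv F G m = Streams.conv (Polynomials.poly-semiring m) (F m) (G m)

positive-conv : ∀ F G n → (∀ k → PositiveAt F k) → (∀ j → j ≤ n → PositiveAt G j) → PositiveAt (conv F G) n
positive-conv F G zero    posF posG = positive-* (posF 0) (posG 0 z≤n)
positive-conv F G (suc n) posF posG = positive-+ (positive-* (posF 0) (posG (suc n) ℕₚ.≤-refl))
  (positive-conv (λ m k → F m (suc k)) G n (λ k → posF (suc k)) (λ j j≤n → posG j (ℕₚ.m≤n⇒m≤1+n j≤n)))

positive-conv-< : ∀ F G n → (λ m → F m 0) ≈ᶠ 0ᶠ → (∀ k → PositiveAt F k) → (∀ {j} → j < n → PositiveAt G j) →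
                  PositiveAt (conv F G) n
positive-conv-< F G zero    F₀ posF posG = positive-resp (λ m → R.trans m (R.*-congʳ m (F₀ m)) (R.zeroˡ m (G m 0))) positive-0
positive-conv-< F G (suc n) F₀ posF posG = positive-resp
  (λ m → R.trans m (R.+-congʳ m (R.trans m (R.*-congʳ m (F₀ m)) (R.zeroˡ m (G m (suc n))))) (R.+-identityˡ m _))
  (positive-conv (λ m k → F m (suc k)) G n (λ k → posF (suc k)) (λ j j≤n → posG (s≤s j≤n)))

-- Positivity of rows and triangles

oddPowerSums : Series
oddPowerSums m = Streams.powerSums (Polynomials.poly-semiring m) (Monomials.variable′ m) (allFin m)

private
  oddPower : ∀ m → Fin m → ℕ → Monomials.Poly m
  oddPower m v = Streams.oddPowers (Polynomials.poly-semiring m) (Monomials.variable′ m v)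

  power : ∀ m → Fin m → ℕ → Monomials.Poly m
  power m v k = Monomials.monomial m (Monomials.variablePower m v k)

-- The two alternatives correspond to even and odd `k`, produced by the recursion in steps of two.
-- The bound `1 ≤ k` in the second makes `k` a legitimate part of a composition.
oddPowers-values : ∀ k → (∀ m v → R._≈_ m (oddPower m v k) (R.0# m))
                       ⊎ (1 ≤ k × ∀ m v → R._≈_ m (oddPower m v k) (R._+_ m (power m v k) (power m v k)))
oddPowers-values 0 = inj₁ λ m v → R.refl m
oddPowers-values 1 = inj₂ (s≤s z≤n , λ m v → R.refl m)
oddPowers-values (suc (suc k)) with oddPowers-values k
... | inj₁ e       = inj₁ λ m v → let x = Monomials.variable′ m v in
        R.trans m (R.*-congˡ m {x} (R.trans m (R.*-congˡ m {x} (e m v)) (R.zeroʳ m x))) (R.zeroʳ m x)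
... | inj₂ (_ , e) = inj₂ (s≤s z≤n , λ m v → let x = Monomials.variable′ m v in
        R.trans m (R.*-congˡ m {x} (R.trans m (R.*-congˡ m {x} (e m v)) (raise m v k))) (raise m v (suc k)))
  where
  raise : ∀ m v k → R._≈_ m (R._*_ m (Monomials.variable′ m v) (R._+_ m (power m v k) (power m v k)))
                            (R._+_ m (power m v (suc k)) (power m v (suc k)))
  raise m v k = pointwise λ f → trans (eval-monomial-* (variablePower v 1) (power m v k +ₚ power m v k) f)
      (cong (λ e → eval (monomial e +ₚ monomial e) f) (variablePower-⊕ v 1 k))
    where open Monomials m

positive-oddPowerSums : ∀ k → PositiveAt oddPowerSums k
positive-oddPowerSums k with oddPowers-values k
... | inj₁ e         = positive-resp
  (λ m → R.trans m (Sums.∑-cong (Polynomials.poly-semiring m) (allFin m) (e m)) (Sums.∑-0 (Polynomials.poly-semiring m) (allFin m)))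
  positive-0
... | inj₂ (1≤k , e) = positive-resp
  (λ m → R.trans m (Sums.∑-cong (Polynomials.poly-semiring m) (allFin m) (e m)) (Sums.∑-+ (Polynomials.poly-semiring m) (allFin m) _ _))
  (positive-+ (positive-p k 1≤k) (positive-p k 1≤k))

rows : Series
rows m = Monomials.straight m true

positive-rows : ∀ n → PositiveAt rows n
positive-rows = <-rec _ go
  where
  go : ∀ n → (∀ {j} → j < n → PositiveAt rows j) → PositiveAt rows n
  go zero    rec = positive-1
  go (suc n) rec = positive-÷ n (λ m → Monomials.newton m (Monomials.leftwards m) (suc n))
    (positive-conv-< oddPowerSums rows (suc n) (λ m → Sums.∑-0 (Polynomials.poly-semiring m) (allFin m)) positive-oddPowerSums rec)

triangles : Series
triangles m = Monomials.tri₃ m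

positive-triangles : ∀ n → PositiveAt triangles n
positive-triangles = <-rec _ go
  where
  positive-P≥₃ : ∀ k → PositiveAt (λ m → Monomials.P≥₃ m) k
  positive-P≥₃ 0             = positive-0
  positive-P≥₃ 1             = positive-0
  positive-P≥₃ (suc (suc k)) = positive-oddPowerSums (suc (suc k))
  shiftᶠ : Series → Series
  shiftᶠ F m = Streams.shift (Polynomials.poly-semiring m) (F m)
  positive-shift : ∀ F → (∀ n → PositiveAt F n) → ∀ n → PositiveAt (shiftᶠ F) n
  positive-shift F pos zero    = positive-0
  positive-shift F pos (suc n) = pos n
  go : ∀ n → (∀ {j} → j < n → PositiveAt triangles j) → PositiveAt triangles n
  go zero    rec = positive-1
  -- `oddPowerSums 1` and `rows 2` are the factors `u` and `h` of `newton-tri₃`, and the triple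
  -- shift supplies the row with three boxes fewer. The second summand uses smaller triangles only,
  -- as `P≥₃` vanishes at 0.
  go (suc n) rec = positive-÷ n (λ m → Monomials.newton-tri₃ m (suc n)) (positive-+
    (positive-* (positive-* (positive-oddPowerSums 1) (positive-rows 2))
                (positive-shift (shiftᶠ (shiftᶠ rows)) (positive-shift (shiftᶠ rows) (positive-shift rows positive-rows)) (suc n)))
    (positive-conv-< (λ m → Monomials.P≥₃ m) triangles (suc n) (λ m → R.refl m) positive-P≥₃ rec))

-- Positivity of the iterated ribbons

PositiveWord : Word → Set
PositiveWord w = Positive (λ m → Monomials.⟪_⟫ m w)

positive-reverse : ∀ t w → PositiveWord w → PositiveWord (reverse (map (image t) w))
positive-reverse t w = positive-resp (λ m → Monomials.⟪⟫-reverse m t w)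

positive-doubling : ∀ s w → PositiveWord w → PositiveWord (w ++ s ∷ reverse (map not w))
-- `positive-÷ n` divides by `suc n`, so this is the division by 2 in `doubling`.
positive-doubling s w pos = positive-÷ 1
  (λ m → R.trans m (R.+-congˡ m {ribbon m} (R.+-identityʳ m (ribbon m))) (Monomials.doubling m s w))
  (positive-* pos pos)
  where
  ribbon : Family
  ribbon m = Monomials.⟪_⟫ m (w ++ s ∷ reverse (map not w))

-- The empty composition is excluded because `wordOf` assigns it the same empty word as a single
-- box.
PositiveRibbon : List ℕ → Set
PositiveRibbon D = D ≢ [] × IsComp D × PositiveWord (wordOf D)

positive-transposed : ∀ {D E} → PositiveRibbon D → Transposed D E → PositiveRibbon E
positive-transposed {[]}     (D≢[] , _)        tr = contradiction refl D≢[]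
positive-transposed {d ∷ ds} {E} (_ , comp , pos) tr with transposed-word d ds E comp tr
... | E≢[] , e = E≢[] , proj₁ tr , subst PositiveWord (sym e) (positive-reverse true (wordOf (d ∷ ds)) pos)

positive-rotated : ∀ {D E} → PositiveRibbon D → Rotated D E → PositiveRibbon E
positive-rotated {[]}     (D≢[] , _)        rot = contradiction refl D≢[]
positive-rotated {d ∷ ds} {E} (_ , comp , pos) rot with rotated-word d ds E comp rot
... | E≢[] , e = E≢[] , proj₁ rot , subst PositiveWord (sym e) (positive-reverse false (wordOf (d ∷ ds)) pos)

positive-tri₁ : ∀ n → PositiveRibbon (tri n 1)
positive-tri₁ n = (λ ()) , ℕₚ.m≤n+m 1 (n ∸ 1) ∷ [] ,
  subst PositiveWord (sym (trans (Listₚ.++-identityʳ _) (cong (λ k → replicate k true) (ℕₚ.m+n∸n≡m (n ∸ 1) 1))))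
    (positive-rows (suc (n ∸ 1)))

positive-tri₃ : ∀ n → PositiveRibbon (tri n 3)
positive-tri₃ n = (λ ()) , ℕₚ.≤-refl ∷ ℕₚ.≤-refl ∷ ℕₚ.m≤n+m 1 (n ∸ 3) ∷ [] ,
  subst (λ w → PositiveWord (false ∷ false ∷ w))
    (sym (trans (Listₚ.++-identityʳ _) (cong (λ k → replicate k true) (ℕₚ.m+n∸n≡m (n ∸ 3) 1))))
    (positive-triangles (suc (suc (suc (n ∸ 3)))))

positive-block : ∀ {B} → BasicBlock B → PositiveRibbon B
positive-block (n , _ , inj₁ refl)                                       = positive-tri₁ n
positive-block (n , _ , inj₂ (inj₁ tr))                                  = positive-transposed (positive-tri₁ n) tr
positive-block (n , _ , inj₂ (inj₂ (_ , inj₁ refl)))                     = positive-tri₃ n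
positive-block (n , _ , inj₂ (inj₂ (_ , inj₂ (inj₁ tr))))                = positive-transposed (positive-tri₃ n) tr
positive-block (n , _ , inj₂ (inj₂ (_ , inj₂ (inj₂ (inj₁ rot)))))        = positive-rotated (positive-tri₃ n) rot
positive-block (n , _ , inj₂ (inj₂ (_ , inj₂ (inj₂ (inj₂ (E , tr , rot)))))) =
  positive-rotated (positive-transposed (positive-tri₃ n) tr) rot

-- Common to both operations: `s` is `false` for concatenation with the transpose and `true` for
-- near concatenation.
positive-join : ∀ s {D E F} → PositiveRibbon D → Transposed D E → IsComp F → F ≢ [] →
  (∀ d ds e es → D ≡ d ∷ ds → E ≡ e ∷ es → wordOf F ≡ wordOf (d ∷ ds) ++ s ∷ wordOf (e ∷ es)) → PositiveRibbon F
positive-join s {[]}     {E}      (D≢[] , _)       tr = contradiction refl D≢[]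
positive-join s {d ∷ ds} {E}  (_ , comp , pos) tr compF F≢[] e with transposed-word d ds E comp tr
positive-join s {d ∷ ds} {[]} (_ , comp , pos) tr compF F≢[] e | E≢[] , _ = contradiction refl E≢[]
positive-join s {d ∷ ds} {e ∷ es} {F} (_ , comp , pos) tr compF F≢[] w≡ | _ , wᵗ≡ = F≢[] , compF ,
  subst PositiveWord (sym (trans (w≡ d ds e es refl refl) (cong (λ u → wordOf (d ∷ ds) ++ s ∷ u) wᵗ≡)))
    (positive-doubling s (wordOf (d ∷ ds)) pos)

positive-reach : ∀ {k D} → Reach k D → PositiveRibbon D
positive-reach (base block) = positive-block block
positive-reach (step11 {D = D} {E} reach tr) with positive-reach reach
... | D⁺@(D≢[] , compD , _) = positive-join false D⁺ tr (Allₚ.++⁺ compD (proj₁ tr)) (λ e → D≢[] (Listₚ.++-conicalˡ D E e))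
        λ { d ds e es refl refl → wordOf-++ d ds e es }
positive-reach (step2 {D = D} {E} reach tr) with positive-reach reach
... | D⁺@(D≢[] , compD , _) = positive-join true D⁺ tr (nearConcat-comp compD (proj₁ tr)) (nearConcat-≢[] D E D≢[])
        λ { d ds e es refl refl → wordOf-nearConcat d ds e es compD (proj₁ tr) }
  where
  nearConcat-≢[] : ∀ D E → D ≢ [] → nearConcat D E ≢ []
  nearConcat-≢[] []            E       D≢[] = contradiction refl D≢[]
  nearConcat-≢[] (_ ∷ [])      []      _    = λ ()
  nearConcat-≢[] (_ ∷ [])      (_ ∷ _) _    = λ ()
  nearConcat-≢[] (_ ∷ _ ∷ _)   E       _    = λ ()

-- Extraction of a coefficient is one of the functionals on which equal polynomials agree, so the
-- expansion of the family gives the required equation for every monomial.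
positive-ribbon : ∀ {D} → PositiveRibbon D → PPositive D
positive-ribbon {[]}     (D≢[] , _)                    = contradiction refl D≢[]
positive-ribbon {d ∷ ds} (_ , comp , L , nonneg , h) = L , nonneg , coefficients
  where
  eval-expand : ∀ m a L → Monomials.coefficient m (expand L m) a ≡
    foldr ℚ._+_ 0ℚ (map (λ { (λs , c) → c ℚ.* toℚ (pcoeff λs m a) }) L)
  eval-expand m a []             = refl
  eval-expand m a ((λs , c) ∷ L) = trans (eval-+ (c • powerSumProduct λs) (expand L m) _)
    (cong₂ ℚ._+_ (trans (eval-• c (powerSumProduct λs) _) (cong (c ℚ.*_) (sym (pcoeff-powerSumProduct λs a))))
                 (eval-expand m a L))
    where open Monomials m
  coefficients : ∀ m a → toℚ (rcoeff (d ∷ ds) m a) ≡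
    foldr ℚ._+_ 0ℚ (map (λ { (λs , c) → c ℚ.* toℚ (pcoeff λs m a) }) L)
  coefficients m a = trans (Monomials.rcoeff-word m d ds a comp)
    (trans (Monomials._≈ₚ_.at (h m) _) (eval-expand m a L))

theorem4p8 : (k : ℕ) (D : List ℕ) → 1 ≤ k → Reach k D → PPositive D
theorem4p8 k D 1≤k reach = positive-ribbon (positive-reach reach)
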